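{- $\mathbf{L_2^P}\subseteq\mathbf{PTW}$.
   Context: Decision problems are identified with languages over $\Sigma=\{0,1\}$ under a standard encoding; $A\leq_P B$ means that $A$ is many-one reducible to $B$ in polynomial time. $\Vert$ denotes concatenation of bit strings. The problem Weak-Tournament-Source: the input is a Boolean circuit $C\colon\{0,1\}^{2n}\to\{0,1\}$; the question is whether there exists $x\in\{0,1\}^n$ such that for all $y\in\{0,1\}^n$ with $y\neq x$ we have $C(x\Vert y)=1$ and $C(y\Vert x)=0$. The class Polynomial Tournament Winner is $\mathbf{PTW}=\{L\subseteq\Sigma^*: L\leq_P \text{Weak-Tournament-Source}\}$. The class $\mathbf{L_2^P}$: a language $L\subseteq\Sigma^*$ is in $\mathbf{L_2^P}$ if there is a polynomial-time predicate $P(\cdot,\cdot,\cdot)$ and a polynomial $p$ such that for all $w\in\Sigma^*$, with $n=|w|$, $P(w,\cdot,\cdot)$ defines a strict total order on $\{0,1\}^{p(n)}$ whose minimal element $a$ has first bit $a_1=L(w)$ (where $L(w)=1$ if $w\in L$ and $L(w)=0$ otherwise). Minimality of $a$ means $P(w,a,b)=1$ for all $b\neq a$. -}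

module Defs where

open import Level using (0ℓ)
open import Data.Bool using (Bool; true; false; not; _∧_; _∨_)
open import Data.Fin using (Fin; toℕ)
open import Data.List using (List; []; _∷_; _++_; map; replicate; length)
open import Data.Maybe as Maybe using (Maybe; just; nothing; maybe′)
open import Data.Nat using (ℕ; zero; suc; _+_; _*_)
open import Data.Product using (Σ; ∃; _×_; _,_)
open import Data.Vec as Vec using (Vec; []; _∷_; toList)
open import Function using (_↔_; _⇔_)
open import Relation.Binary.PropositionalEquality using (_≡_; _≢_)
open import Relation.Binary.Structures using (IsStrictTotalOrder)
open import Relation.Nullary.Reflects using (Reflects)
open import Relation.Unary using (Pred)

Language : Set₁
Language = Pred (List Bool) 0ℓ

-- A polynomial with natural-number coefficients, constant term first.
Polynomial : Set
Polynomial = List ℕ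

⟦_⟧ : Polynomial → ℕ → ℕ
⟦ [] ⟧     n = 0
⟦ c ∷ cs ⟧ n = c + n * ⟦ cs ⟧ n

------------------------------------------------------------------------
-- Deterministic multi-tape Turing machines

-- The tape alphabet: blank, 0, 1 and g auxiliary symbols.
data Symbol (g : ℕ) : Set where
  blank : Symbol g
  bit   : Bool → Symbol g
  aux   : Fin g → Symbol g

data Move : Set where
  left stay right : Move

-- A two-way infinite tape: the cells to the left of the head (nearest
-- first), the scanned cell, and the cells to its right (nearest first).
-- All cells beyond the two lists are blank.
record Tape (g : ℕ) : Set where
  constructor tape
  field
    before  : List (Symbol g)
    scanned : Symbol g
    after   : List (Symbol g)

blankTape : ∀ {g} → Tape g
blankTape = tape [] blank []

writeMove : ∀ {g} → Symbol g × Move → Tape g → Tape g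
writeMove (s , left)  (tape []       _ rs)       = tape [] blank (s ∷ rs)
writeMove (s , left)  (tape (l ∷ ls) _ rs)       = tape ls l (s ∷ rs)
writeMove (s , stay)  (tape ls       _ rs)       = tape ls s rs
writeMove (s , right) (tape ls       _ [])       = tape (s ∷ ls) blank []
writeMove (s , right) (tape ls       _ (r ∷ rs)) = tape (s ∷ ls) r rs

-- The head starts on the first bit of the string (if there is one).
load : ∀ {g} → List Bool → Tape g
load []       = blankTape
load (b ∷ bs) = tape [] (bit b) (map bit bs)

-- The bits from the scanned cell rightwards, up to the first non-bit.
unload : ∀ {g} → Tape g → List Bool
unload (tape _ s rs) = bits (s ∷ rs)
  where
  bits : List (Symbol _) → List Bool
  bits (bit b ∷ ss) = b ∷ bits ss
  bits _            = []

-- A machine taking m input strings has an output tape, m input tapes and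
-- some number of work tapes, in this order; all heads may read, write and
-- move both ways.  It halts when δ yields nothing.
record Machine (m : ℕ) : Set₁ where
  field
    State     : Set
    finite    : ∃ λ q → State ↔ Fin q
    start     : State
    auxiliary : ℕ
    work      : ℕ

  tapes : ℕ
  tapes = suc (m + work)

  field
    δ : State → Vec (Symbol auxiliary) tapes →
        Maybe (State × Vec (Symbol auxiliary × Move) tapes)

  Config : Set
  Config = State × Vec (Tape auxiliary) tapes

  initial : Vec (List Bool) m → Config
  initial xs =
    start , blankTape ∷ (Vec.map load xs Vec.++ Vec.replicate work blankTape)

  step : Config → Maybe Config
  step (q , ts) =
    Maybe.map (λ (q′ , as) → q′ , Vec.zipWith writeMove as ts)
              (δ q (Vec.map Tape.scanned ts))

  -- At most t steps; a halted configuration is left unchanged.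
  run : ℕ → Config → Config
  run zero    c = c
  run (suc t) c = maybe′ (run t) c (step c)

  output : Config → List Bool
  output (_ , t ∷ _) = unload t

  HaltsWithin : ℕ → Vec (List Bool) m → List Bool → Set
  HaltsWithin t xs ys =
    step (run t (initial xs)) ≡ nothing × output (run t (initial xs)) ≡ ys

PolyTime : ∀ {m} → (Vec (List Bool) m → List Bool) → Set₁
PolyTime {m} f =
  Σ (Machine m) λ M → ∃ λ (t : Polynomial) → ∀ xs →
    Machine.HaltsWithin M (⟦ t ⟧ (Vec.sum (Vec.map length xs))) xs (f xs)

PolyTimeFunction : (List Bool → List Bool) → Set₁
PolyTimeFunction f = PolyTime {1} λ { (x ∷ []) → f x }

PolyTimePredicate₃ : (List Bool → List Bool → List Bool → Bool) → Set₁
PolyTimePredicate₃ P = PolyTime {3} λ { (x ∷ y ∷ z ∷ []) → P x y z ∷ [] }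

infix 4 _≤P_

_≤P_ : Language → Language → Set₁
A ≤P B = ∃ λ f → PolyTimeFunction f × (∀ w → A w ⇔ B (f w))

------------------------------------------------------------------------
-- Boolean circuits

data Gate (k : ℕ) : Set where
  const   : Bool → Gate k
  neg     : Fin k → Gate k
  and or  : Fin k → Fin k → Gate k

-- A circuit over k available wires, listed in topological order: each gate
-- adds a wire, which becomes wire 0 and shifts the earlier ones up by one.
-- Wires may be used any number of times, so these are DAGs, not formulas.
data Circuit (k : ℕ) : Set where
  result : Fin k → Circuit k
  gate   : Gate k → Circuit (suc k) → Circuit k

evalGate : ∀ {k} → Gate k → Vec Bool k → Bool
evalGate (const b) v = b
evalGate (neg i)   v = not (Vec.lookup v i)
evalGate (and i j) v = Vec.lookup v i ∧ Vec.lookup v j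
evalGate (or i j)  v = Vec.lookup v i ∨ Vec.lookup v j

eval : ∀ {k} → Circuit k → Vec Bool k → Bool
eval (result i) v = Vec.lookup v i
eval (gate g C) v = eval C (evalGate g v ∷ v)

-- Numbers are written in unary and self-delimiting.  As every wire is an
-- input or the output of a listed gate, this lengthens the description of a
-- circuit only polynomially compared with binary wire names.
unary : ℕ → List Bool
unary n = replicate n true ++ false ∷ []

encodeGate : ∀ {k} → Gate k → List Bool
encodeGate (const b) = false ∷ false ∷ b ∷ []
encodeGate (neg i)   = false ∷ true  ∷ unary (toℕ i)
encodeGate (and i j) = true  ∷ false ∷ unary (toℕ i) ++ unary (toℕ j)
encodeGate (or i j)  = true  ∷ true  ∷ unary (toℕ i) ++ unary (toℕ j)

encodeBody : ∀ {k} → Circuit k → List Bool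
encodeBody (result i) = false ∷ unary (toℕ i)
encodeBody (gate g C) = true ∷ encodeGate g ++ encodeBody C

encode : ∀ {k} → Circuit k → List Bool
encode {k} C = unary k ++ encodeBody C

------------------------------------------------------------------------
-- The problem and the two classes

HasWeakSource : ∀ n → Circuit (n + n) → Set
HasWeakSource n C = ∃ λ (x : Vec Bool n) → ∀ (y : Vec Bool n) → y ≢ x →
  eval C (x Vec.++ y) ≡ true × eval C (y Vec.++ x) ≡ false

WeakTournamentSource : Language
WeakTournamentSource w =
  ∃ λ n → ∃ λ (C : Circuit (n + n)) → w ≡ encode C × HasWeakSource n C

PTW : Pred Language _
PTW L = L ≤P WeakTournamentSource

-- Reflects (L w) b says that b is the value L(w) of the characteristic
-- function.  That a has a first bit forces ⟦ p ⟧ (length w) to be positive.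
L₂ᴾ : Pred Language _
L₂ᴾ L =
  ∃ λ (P : List Bool → List Bool → List Bool → Bool) →
  ∃ λ (p : Polynomial) →
    PolyTimePredicate₃ P ×
    (∀ w →
      let Str = Vec Bool (⟦ p ⟧ (length w))
          _≺_ = λ (a b : Str) → P w (toList a) (toList b) ≡ true
      in
      IsStrictTotalOrder _≡_ _≺_ ×
      (∃ λ (a : Str) →
        (∀ (b : Str) → b ≢ a → a ≺ b) ×
        (∃ λ a₁ → ∃ λ as → toList a ≡ a₁ ∷ as × Reflects (L w) a₁)))

{-# OPTIONS --safe #-}
module Submission where

-- On input w, let C(x‖y) = P(w,x,y) ∧ x₁ with |x| = |y| = p(|w|).  The only
-- candidate for a weak source of C is the minimal element a of the order, as
-- any other x would need P(w,x,a) = 1; and a is one exactly if a₁ = 1.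
--
-- To print C in polynomial time, the machine for P is simulated by a linear
-- array of cells, in which cell j holds the symbols at distance j + 1 on both
-- sides of each head, together with the state and the scanned symbols.  A
-- cell is updated by a fixed Boolean function of itself, its neighbours and
-- cell 0.  As heads stay put while tapes move, all cells perform the same
-- operations; storing the i-th bits of all cells in consecutive wires turns
-- each operation into one gate repeated with constant relative references.
-- The description of C is thus a nest of repetitions of fixed strings and
-- unary numbers, with multiplicities polynomial in |w|, apart from one loop
-- over the bits of w.

open import Defs
open import Data.Bool using (Bool; true; false; not; _∧_; _∨_; if_then_else_)
import Data.Bool.Properties as Bool
open import Data.Fin using (Fin; zero; suc; toℕ; splitAt)
open import Data.Fin.Patterns using (0F; 1F; 2F; 3F; 4F; 5F)
open import Data.Fin.Properties using (+↔⊎; 1↔⊤; 0≢1+n; toℕ-injective)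
import Data.Fin.Properties as Fin
open import Data.List using (List; []; _∷_; _++_; map; length; reverse; _ʳ++_; concatMap)
import Data.List as List
open import Data.List.Properties
  using (++-assoc; ++-identityʳ; reverse-map; reverse-involutive; ʳ++-defn; ∷-injectiveˡ;
         ∷-injectiveʳ; length-++; length-map; length-reverse; map-id)
open import Data.Maybe using (Maybe; just; nothing; maybe′)
import Data.Maybe as Maybe
open import Data.Nat using (ℕ; zero; suc; _+_; _*_; _≤_; _<_; z≤n; s≤s; _⊔_)
open import Data.Nat.Properties
  using (≤-refl; ≤-trans; ≤-reflexive; <⇒≤; n≤1+n; m≤m+n; m≤n+m; m≤n⇒m<n∨m≡n; m≤n⇒m≤1+n;
         +-mono-≤; +-monoˡ-≤; m⊔n≤o⇒m≤o; m⊔n≤o⇒n≤o; +-comm; +-suc; +-identityʳ; *-zeroʳ;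
         suc-injective)
open import Data.Nat.Tactic.RingSolver using (solve-∀)
open import Data.Product using (∃; _×_; _,_; proj₁; proj₂)
open import Data.Sum using (_⊎_; inj₁; inj₂; [_,_]′)
open import Data.Sum.Function.Propositional using (_⊎-↔_)
open import Data.Unit using (⊤; tt)
open import Data.Vec using (Vec; []; _∷_; toList; lookup; _[_]≔_; zipWith; replicate; _∷ʳ_)
import Data.Vec as Vec
open import Data.Vec.Properties
  using (map-∘; map-cong; map-++; map-replicate; zipWith-replicate; lookup-map; lookup-zipWith;
         lookup-replicate; lookup-splitAt; lookup∘tabulate; tabulate-cong; tabulate∘lookup;
         []≔-lookup; []≔-idempotent; lookup∘update; lookup∘update′; length-toList; toList-++; ≡-dec)
open import Function using (_↔_; _⇔_; _∘_; mk↔ₛ′; mk⇔; Inverse)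
open import Function.Properties.Inverse using (↔-sym; ↔-trans)
open import Relation.Binary.PropositionalEquality
  using (_≡_; _≢_; refl; sym; trans; cong; cong₂; subst; subst₂)
open import Relation.Binary.Structures using (IsStrictTotalOrder)
open import Relation.Nullary using (¬_; yes; no; contradiction)
open import Relation.Nullary.Reflects using (Reflects; ofʸ; ofⁿ)
open import Relation.Unary using (_⊆_)

-- The reduction has to be an explicit Turing machine with an explicit time bound, and this dictates
-- the shape of the circuit. Only one kind of machine is built: a printer for the expressions `Exp`,
-- whose sole control structure is a loop over the bits of w. Such loops cannot compute an address,
-- so a repeated gate must read the same in every round. Numbering wires from the newest one makes
-- this possible: as each round adds a wire, a constant reference denotes the adjacent wire in the
-- next round. A cell whose treatment depended on the head position would spoil the uniformity.
--
-- A halted configuration is left unchanged by `run`, so the circuit can simulate a fixed number T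
-- of steps, the value of the time bound; T depends on |w| alone because x and y have length p(|w|).
-- References to wires remain natural numbers up to the end, where an evaluation on one input shows
-- them to be in range. Finally, membership in `WeakTournamentSource` only provides some circuit
-- with the printed code, so `encode` must be shown injective to identify it with the constructed
-- one.

private
  variable
    d k m n : ℕ

Maybe-↔ : ∀ {A : Set} {k} → A ↔ Fin k → Maybe A ↔ Fin (suc k)
Maybe-↔ {A} {k} f = mk↔ₛ′ there back there∘back back∘there
  where
  there : Maybe A → Fin (suc k)
  there nothing  = zero
  there (just a) = suc (Inverse.to f a)
  back : Fin (suc k) → Maybe A
  back zero    = nothing
  back (suc i) = just (Inverse.from f i)
  there∘back : ∀ i → there (back i) ≡ i
  there∘back zero    = refl
  there∘back (suc i) = cong suc (Inverse.strictlyInverseˡ f i)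
  back∘there : ∀ a → back (there a) ≡ a
  back∘there nothing  = refl
  back∘there (just a) = cong just (Inverse.strictlyInverseʳ f a)

-- Structured programs over multi-tape configurations

Sym : Set
Sym = Symbol 0

Tapes : ℕ → Set
Tapes = Vec (Tape 0)

data Prog (n : ℕ) : Set where
  act   : (Vec Sym n → Vec (Sym × Move) n) → Prog n
  _⨾_   : Prog n → Prog n → Prog n
  -- Run the first body on 0 and the second on 1 until the scanned cell of
  -- the given tape is not a bit.
  while : Fin n → Prog n → Prog n → Prog n

infixr 5 _⨾_

-- Control points. A loop has one of its own, its test, which spends a step without moving any head;
-- leaving a program is the `nothing` returned by `next`.
PC : Prog n → Set
PC (act f)       = ⊤
PC (p ⨾ q)       = PC p ⊎ PC q
PC (while j p q) = ⊤ ⊎ (PC p ⊎ PC q)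

PC-finite : (p : Prog n) → ∃ λ k → PC p ↔ Fin k
PC-finite (act f) = 1 , ↔-sym 1↔⊤
PC-finite (p ⨾ q) with PC-finite p | PC-finite q
... | k , f | l , g = k + l , ↔-trans (f ⊎-↔ g) (↔-sym +↔⊎)
PC-finite (while j p q) with PC-finite p | PC-finite q
... | k , f | l , g =
  1 + (k + l) ,
  ↔-trans (↔-sym 1↔⊤ ⊎-↔ ↔-trans (f ⊎-↔ g) (↔-sym +↔⊎)) (↔-sym +↔⊎)

entry : (p : Prog n) → PC p
entry (act f)       = tt
entry (p ⨾ q)       = inj₁ (entry p)
entry (while j p q) = inj₁ tt

idle : Vec Sym n → Vec (Sym × Move) n
idle = Vec.map λ s → s , stay

choose : ∀ {A : Set} → A → A → Sym → Maybe A
choose a b (bit false) = just a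
choose a b (bit true)  = just b
choose a b _           = nothing

next : (p : Prog n) → PC p → Vec Sym n → Maybe (PC p) × Vec (Sym × Move) n
next (act f) tt ss = nothing , f ss
next (p ⨾ q) (inj₁ c) ss with next p c ss
... | r , as = just (maybe′ inj₁ (inj₂ (entry q)) r) , as
next (p ⨾ q) (inj₂ c) ss with next q c ss
... | r , as = Maybe.map inj₂ r , as
next (while j p q) (inj₁ tt) ss =
  choose (inj₂ (inj₁ (entry p))) (inj₂ (inj₂ (entry q))) (lookup ss j) , idle ss
next (while j p q) (inj₂ (inj₁ c)) ss with next p c ss
... | r , as = just (maybe′ (inj₂ ∘ inj₁) (inj₁ tt) r) , as
next (while j p q) (inj₂ (inj₂ c)) ss with next q c ss
... | r , as = just (maybe′ (inj₂ ∘ inj₂) (inj₁ tt) r) , as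

heads : Tapes n → Vec Sym n
heads = Vec.map Tape.scanned

perform : (Vec Sym n → Vec (Sym × Move) n) → Tapes n → Tapes n
perform f ts = zipWith writeMove (f (heads ts)) ts

perform-idle : (ts : Tapes n) → perform idle ts ≡ ts
perform-idle []       = refl
perform-idle (t ∷ ts) = cong (t ∷_) (perform-idle ts)

data Exec {n} : Prog n → Tapes n → ℕ → Tapes n → Set where
  act  : ∀ {f ts} → Exec (act f) ts 1 (perform f ts)
  seq  : ∀ {p q ts us vs k l} →
         Exec p ts k us → Exec q us l vs → Exec (p ⨾ q) ts (k + l) vs
  done : ∀ {j p q ts} → lookup (heads ts) j ≡ blank → Exec (while j p q) ts 1 ts
  loop : ∀ {j p q ts us vs k l} b → lookup (heads ts) j ≡ bit b →
         Exec (if b then q else p) ts k us → Exec (while j p q) us l vs →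
         Exec (while j p q) ts (suc (k + l)) vs

data Runs {n} (p : Prog n) : Maybe (PC p) → Tapes n → ℕ → Tapes n → Set where
  exit : ∀ {ts} → Runs p nothing ts 0 ts
  tick : ∀ {c ts us k} →
         Runs p (proj₁ (next p c (heads ts))) (perform (proj₂ ∘ next p c) ts) k us →
         Runs p (just c) ts (suc k) us

runs-right : ∀ {p q : Prog n} {r ts k us} →
             Runs q r ts k us → Runs (p ⨾ q) (Maybe.map inj₂ r) ts k us
runs-right exit     = exit
runs-right (tick s) = tick (runs-right s)

-- When the first program exits, control is already at the entry of the second, so no step is lost
-- in between and the times add up exactly.
runs-seq : ∀ {p q : Prog n} {r ts k us l vs} →
           Runs p r ts k us → Runs q (just (entry q)) us l vs →
           Runs (p ⨾ q) (just (maybe′ inj₁ (inj₂ (entry q)) r)) ts (k + l) vs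
runs-seq exit     s′ = runs-right s′
runs-seq (tick s) s′ = tick (runs-seq s s′)

runs-body₀ : ∀ {j} {p q : Prog n} {r ts k us l vs} →
             Runs p r ts k us → Runs (while j p q) (just (inj₁ tt)) us l vs →
             Runs (while j p q) (just (maybe′ (inj₂ ∘ inj₁) (inj₁ tt) r)) ts (k + l) vs
runs-body₀ exit     s′ = s′
runs-body₀ (tick s) s′ = tick (runs-body₀ s s′)

runs-body₁ : ∀ {j} {p q : Prog n} {r ts k us l vs} →
             Runs q r ts k us → Runs (while j p q) (just (inj₁ tt)) us l vs →
             Runs (while j p q) (just (maybe′ (inj₂ ∘ inj₂) (inj₁ tt) r)) ts (k + l) vs
runs-body₁ exit     s′ = s′
runs-body₁ (tick s) s′ = tick (runs-body₁ s s′)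

runs-test : ∀ {j} {p q : Prog n} {ts k us s} → lookup (heads ts) j ≡ s →
            Runs (while j p q)
              (choose (inj₂ (inj₁ (entry p))) (inj₂ (inj₂ (entry q))) s) ts k us →
            Runs (while j p q) (just (inj₁ tt)) ts (suc k) us
runs-test {j = j} {p} {q} {ts} {k} {us} refl s =
  tick (subst (λ ts′ → Runs (while j p q) (choose _ _ (lookup (heads ts) j)) ts′ k us)
          (sym (perform-idle ts)) s)

exec⇒runs : ∀ {p : Prog n} {ts k us} → Exec p ts k us → Runs p (just (entry p)) ts k us
exec⇒runs act                = tick exit
exec⇒runs (seq e e′)         = runs-seq (exec⇒runs e) (exec⇒runs e′)
exec⇒runs (done eq)          = runs-test eq exit
exec⇒runs (loop false eq e e′) = runs-test eq (runs-body₀ (exec⇒runs e) (exec⇒runs e′))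
exec⇒runs (loop true eq e e′)  = runs-test eq (runs-body₁ (exec⇒runs e) (exec⇒runs e′))

machine : ∀ d → Prog (suc (suc d)) → Machine 1
machine d p = record
  { State     = Maybe (PC p)
  ; finite    = suc (proj₁ (PC-finite p)) , Maybe-↔ (proj₂ (PC-finite p))
  ; start     = just (entry p)
  ; auxiliary = 0
  ; work      = d
  ; δ         = λ { nothing ss → nothing ; (just c) ss → just (next p c ss) }
  }

runs⇒run : ∀ {p : Prog (suc (suc d))} {r ts k us} l → Runs p r ts k us → k ≤ l →
           Machine.run (machine d p) l (r , ts) ≡ (nothing , us)
runs⇒run zero    exit     z≤n     = refl
runs⇒run (suc l) exit     z≤n     = refl
runs⇒run (suc l) (tick s) (s≤s h) = runs⇒run l s h

-- A bound in place of an exact time lets the two bodies of a loop be charged alike.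
Within : Prog n → Tapes n → ℕ → Tapes n → Set
Within p ts m us = ∃ λ k → k ≤ m × Exec p ts k us

within-≤ : ∀ {p : Prog n} {ts k l us} → k ≤ l → Within p ts k us → Within p ts l us
within-≤ h (k , h′ , e) = k , ≤-trans h′ h , e

within-to : ∀ {p : Prog n} {ts k us vs} → us ≡ vs → Within p ts k us → Within p ts k vs
within-to refl h = h

within-seq : ∀ {p q : Prog n} {ts us vs k l} →
             Within p ts k us → Within q us l vs → Within (p ⨾ q) ts (k + l) vs
within-seq (_ , h , e) (_ , h′ , e′) = _ , +-mono-≤ h h′ , seq e e′

within-done : ∀ {j} {p q : Prog n} {ts} →
              lookup (heads ts) j ≡ blank → Within (while j p q) ts 1 ts
within-done eq = _ , ≤-refl , done eq

within-loop : ∀ {j} {p q : Prog n} {ts us vs k l} b → lookup (heads ts) j ≡ bit b →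
              Within (if b then q else p) ts k us → Within (while j p q) us l vs →
              Within (while j p q) ts (suc (k + l)) vs
within-loop b eq (_ , h , e) (_ , h′ , e′) = _ , s≤s (+-mono-≤ h h′) , loop b eq e e′

on : Fin n → (Sym → Sym × Move) → Prog n
on j g = act λ ss → idle ss [ j ]≔ g (lookup ss j)

perform-on : ∀ (j : Fin n) (g : Sym → Sym × Move) (ts : Tapes n) → let t = lookup ts j in
  perform (λ ss → idle ss [ j ]≔ g (lookup ss j)) ts
    ≡ ts [ j ]≔ writeMove (g (Tape.scanned t)) t
perform-on zero    g (t ∷ ts) = cong (writeMove (g (Tape.scanned t)) t ∷_) (perform-idle ts)
perform-on (suc j) g (t ∷ ts) = cong (t ∷_) (perform-on j g ts)

shift : Move → Fin n → Prog n
shift m j = on j λ s → s , m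

shifted : Move → Tape 0 → Tape 0
shifted m t = writeMove (Tape.scanned t , m) t

within-shift : ∀ (j : Fin n) m o ts t →
  Within (shift m (suc j)) (o ∷ ts [ j ]≔ t) 1 (o ∷ ts [ j ]≔ shifted m t)
within-shift j m o ts t =
  1 , ≤-refl , subst (Exec _ _ 1) eq act
  where
  eq : perform (λ ss → idle ss [ suc j ]≔ (lookup ss (suc j) , m)) (o ∷ ts [ j ]≔ t)
       ≡ o ∷ ts [ j ]≔ shifted m t
  eq = trans (perform-on (suc j) (λ s → s , m) (o ∷ ts [ j ]≔ t))
      (cong (o ∷_) (trans (cong (λ u → ts [ j ]≔ t [ j ]≔ shifted m u) (lookup∘update j ts t))
                          ([]≔-idempotent ts j)))

at-cong : ∀ (j : Fin n) o ts {t u} → t ≡ u →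
          _≡_ {A = Tapes (suc n)} (o ∷ ts [ j ]≔ t) (o ∷ ts [ j ]≔ u)
at-cong j o ts = cong (λ t → o ∷ ts [ j ]≔ t)

lookup-heads : ∀ (ts : Tapes n) j → lookup (heads ts) j ≡ Tape.scanned (lookup ts j)
lookup-heads (t ∷ ts) zero    = refl
lookup-heads (t ∷ ts) (suc j) = lookup-heads ts j

head-≔ : ∀ (ts : Tapes n) j t → lookup (heads (ts [ j ]≔ t)) j ≡ Tape.scanned t
head-≔ ts j t = trans (lookup-heads (ts [ j ]≔ t) j) (cong Tape.scanned (lookup∘update j ts t))

-- String expressions

data Exp : Set where
  ε    : Exp
  bit  : Bool → Exp
  _·_  : Exp → Exp → Exp
  each : Exp → Exp → Exp

infixr 6 _·_

-- The order produced by scanning a word from the left while printing from the right: the first bit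
-- contributes the last piece.
revConcat : ∀ {A B : Set} → (A → List B) → List A → List B
revConcat f []       = []
revConcat f (x ∷ xs) = revConcat f xs ++ f x

str : Exp → List Bool → List Bool
str ε          w = []
str (bit b)    w = b ∷ []
str (e · e′)   w = str e w ++ str e′ w
str (each a b) w = revConcat (λ c → if c then str b w else str a w) w

-- The number of copies of the input word that are required: a nested loop must not move the head of
-- the enclosing one, while loops in sequence can share a tape.
depth : Exp → ℕ
depth ε          = 0
depth (bit b)    = 0
depth (e · e′)   = depth e ⊔ depth e′
depth (each a b) = suc (depth a ⊔ depth b)

-- The output head moves left, so that a string is printed from its end.
compile : Exp → (Fin d → Fin n) → Prog (suc n)
compile ε        ι = act idle
compile (bit b)  ι = on zero (λ _ → bit b , left)
compile (e · e′) ι = compile e′ ι ⨾ compile e ι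
-- No tape is left for this loop; `depth e ≤ d` in `within-compile` excludes the case.
compile {zero}  (each a b) ι = act idle
compile {suc d} (each a b) ι =
  -- The head rests behind the word. It is brought to the blank before the word and then onto the
  -- first bit; the scan takes it back to its resting place.
  shift left j ⨾ while j (shift left j) (shift left j) ⨾ shift right j ⨾
  while j (compile a (ι ∘ suc) ⨾ shift right j) (compile b (ι ∘ suc) ⨾ shift right j)
  where j = suc (ι zero)

-- Both bodies of a loop are charged, by sum rather than maximum, so that the cost is a polynomial.
-- The other terms count two single moves, two final tests, and a test and a move in each of the N
-- rounds of rewinding and of scanning.
cost : Exp → ℕ → ℕ
cost ε          N = 1
cost (bit b)    N = 1
cost (e · e′)   N = cost e′ N + cost e N
cost (each a b) N = 4 + 2 * N + N * (2 + (cost a N + cost b N))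

-- The word w with the head on the blank behind it; the blank before it
-- is what going to the left end of w leaves there.
resting : List Bool → Tape 0
resting w = tape (map bit w ʳ++ (blank ∷ [])) blank []

rewound : List Bool → List Sym → Tape 0
rewound []      rs = tape [] blank rs
rewound (b ∷ u) rs = tape (map bit u ++ blank ∷ []) (bit b) rs

shift-rewound : ∀ b u rs → shifted left (rewound (b ∷ u) rs) ≡ rewound u (bit b ∷ rs)
shift-rewound b []      rs = refl
shift-rewound b (c ∷ u) rs = refl

shift-resting : ∀ w → shifted left (resting w) ≡ rewound (reverse w) (blank ∷ [])
shift-resting w = trans (cong (λ ls → shifted left (tape ls blank [])) eq) (go (reverse w))
  where
  eq : map bit w ʳ++ (blank ∷ []) ≡ map bit (reverse w) ++ blank ∷ []
  eq = trans (ʳ++-defn (map bit w)) (cong (_++ blank ∷ []) (sym (reverse-map bit w)))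
  go : ∀ u → shifted left (tape (map bit u ++ blank ∷ []) blank []) ≡ rewound u (blank ∷ [])
  go []      = refl
  go (b ∷ u) = refl

scanning : List Sym → List Bool → Tape 0
scanning ls []      = tape ls blank []
scanning ls (b ∷ v) = tape ls (bit b) (map bit v ++ blank ∷ [])

shift-scanning : ∀ ls b v → shifted right (scanning ls (b ∷ v)) ≡ scanning (bit b ∷ ls) v
shift-scanning ls b []      = refl
shift-scanning ls b (c ∷ v) = refl

shift-leftmost : ∀ w →
  shifted right (tape [] blank (map bit w ++ blank ∷ [])) ≡ scanning (blank ∷ []) w
shift-leftmost []      = refl
shift-leftmost (b ∷ w) = refl

within-rewind : ∀ (j : Fin n) o ts u rs →
  Within (while (suc j) (shift left (suc j)) (shift left (suc j)))
    (o ∷ ts [ j ]≔ rewound u rs) (1 + 2 * length u)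
    (o ∷ ts [ j ]≔ tape [] blank (map bit u ʳ++ rs))
within-rewind j o ts []      rs = within-done (head-≔ ts j _)
within-rewind j o ts (b ∷ u) rs =
  within-≤ (≤-reflexive (arith (length u)))
    (within-loop b (head-≔ ts j _)
      (body b (within-to (at-cong j o ts (shift-rewound b u rs))
                (within-shift j left o ts (rewound (b ∷ u) rs))))
      (within-rewind j o ts u (bit b ∷ rs)))
  where
  arith : ∀ k → suc (1 + (1 + 2 * k)) ≡ 1 + 2 * suc k
  arith = solve-∀
  body : ∀ c {p : Prog n} {ts k us} → Within p ts k us → Within (if c then p else p) ts k us
  body false h = h
  body true  h = h

printed : List Bool → Tape 0
printed s = tape [] blank (map bit s)

Rest : (Fin d → Fin n) → List Bool → Tapes n → Set
Rest ι w ts = ∀ i → lookup ts (ι i) ≡ resting w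

Injective : (Fin d → Fin n) → Set
Injective ι = ∀ {i j} → ι i ≡ ι j → i ≡ j

-- The invariant is that all tapes supplied by `ι` are at rest, before and after. Injectivity of `ι`
-- keeps the tape of an enclosing loop, which is in the middle of its scan, out of the supply of the
-- inner loops.
within-compile : ∀ e (ι : Fin d → Fin n) w ts s →
  depth e ≤ d → Injective ι → Rest ι w ts →
  Within (compile e ι) (printed s ∷ ts) (cost e (length w)) (printed (str e w ++ s) ∷ ts)
within-compile ε ι w ts s h inj r = 1 , ≤-refl , subst (Exec _ _ 1) (perform-idle _) act
within-compile (bit b) ι w ts s h inj r =
  1 , ≤-refl , subst (Exec _ _ 1) (cong (_ ∷_) (perform-idle ts)) act
within-compile (e · e′) ι w ts s h inj r =
  within-seq (within-compile e′ ι w ts s (m⊔n≤o⇒n≤o (depth e) (depth e′) h) inj r)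
    (subst (λ u → Within (compile e ι) (printed (str e′ w ++ s) ∷ ts) _ (printed u ∷ ts))
       (sym (++-assoc (str e w) (str e′ w) s))
       (within-compile e ι w ts (str e′ w ++ s) (m⊔n≤o⇒m≤o (depth e) (depth e′) h) inj r))
within-compile {suc d} (each a b) ι w ts s (s≤s h) inj r =
  within-≤ (≤-reflexive (arith (length w) (cost a (length w) + cost b (length w))))
   (subst₂ (λ us vs → Within (compile (each a b) ι) (printed s ∷ us)
                        (1 + (1 + 2 * N + (1 + (1 + N * (2 + C)))))
                        (printed (str (each a b) w ++ s) ∷ vs))
     start-eq start-eq
    (within-seq
      (within-to (at-cong j _ ts (shift-resting w))
         (within-shift j left _ ts (resting w)))
    (within-seq
      (within-to (at-cong j _ ts rewind-eq)
       (within-≤ (≤-reflexive (cong (λ k → 1 + 2 * k) (length-reverse w)))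
         (within-rewind j _ ts (reverse w) (blank ∷ []))))
    (within-seq
      (within-to (at-cong j _ ts (shift-leftmost w))
         (within-shift j right _ ts _))
      (scan (blank ∷ []) w s)))))
  where
  j = ι zero
  arith : ∀ N c → 1 + (1 + 2 * N + (1 + (1 + N * (2 + c)))) ≡ 4 + 2 * N + N * (2 + c)
  arith = solve-∀
  start-eq : ts [ j ]≔ resting w ≡ ts
  start-eq = trans (cong (ts [ j ]≔_) (sym (r zero))) ([]≔-lookup ts j)
  rewind-eq : tape [] blank (map bit (reverse w) ʳ++ (blank ∷ []))
              ≡ tape [] blank (map bit w ++ blank ∷ [])
  rewind-eq = cong (tape [] blank)
    (trans (ʳ++-defn (map bit (reverse w)))
      (cong (_++ blank ∷ [])
        (trans (sym (reverse-map bit (reverse w))) (cong (map bit) (reverse-involutive w)))))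
  rest′ : ∀ t → Rest (ι ∘ suc) w (ts [ j ]≔ t)
  rest′ t i = trans (lookup∘update′ (λ eq → 0≢1+n (sym (inj eq))) ts t) (r (suc i))
  inj′ : Injective (ι ∘ suc)
  inj′ eq = Fin.suc-injective (inj eq)
  N C : ℕ
  N = length w
  C = cost a N + cost b N
  p q : Prog _
  p = compile a (ι ∘ suc) ⨾ shift right (suc j)
  q = compile b (ι ∘ suc) ⨾ shift right (suc j)
  str-c : Bool → List Bool
  str-c c = if c then str b w else str a w
  body : ∀ c s t →
    Within (if c then q else p) (printed s ∷ ts [ j ]≔ t) (1 + C)
      (printed (str-c c ++ s) ∷ ts [ j ]≔ shifted right t)
  body false s t = within-≤ (≤-trans (≤-reflexive (+-comm _ 1)) (s≤s (m≤m+n _ _)))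
    (within-seq (within-compile a (ι ∘ suc) w _ s (m⊔n≤o⇒m≤o (depth a) (depth b) h) inj′ (rest′ t))
                (within-shift j right _ ts t))
  body true s t = within-≤ (≤-trans (≤-reflexive (+-comm _ 1)) (s≤s (m≤n+m _ _)))
    (within-seq (within-compile b (ι ∘ suc) w _ s (m⊔n≤o⇒n≤o (depth a) (depth b) h) inj′ (rest′ t))
                (within-shift j right _ ts t))
  scan : ∀ ls v s →
    Within (while (suc j) p q) (printed s ∷ ts [ j ]≔ scanning ls v) (1 + length v * (2 + C))
      (printed (revConcat str-c v ++ s) ∷ ts [ j ]≔ tape (map bit v ʳ++ ls) blank [])
  scan ls []      s = within-done (head-≔ ts j _)
  scan ls (c ∷ v) s =
    within-≤ (≤-reflexive (arith′ (length v * (2 + C))))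
     (within-loop c (head-≔ ts j _)
       (within-to (at-cong j _ ts (shift-scanning ls c v)) (body c s _))
       (within-to
         (cong (λ u → printed u ∷ ts [ j ]≔ tape (map bit v ʳ++ (bit c ∷ ls)) blank [])
           (sym (++-assoc (revConcat str-c v) (str-c c) s)))
         (scan (bit c ∷ ls) v (str-c c ++ s))))
    where
    arith′ : ∀ k → suc (1 + C + (1 + k)) ≡ 1 + (2 + C + k)
    arith′ k = cong (λ z → suc (suc z)) (+-suc C k)

-- Printing an expression in polynomial time

-- The move leaves the blank that `resting` has before the word, so that tapes agree as data and not
-- merely up to blanks.
prepare : Vec Sym (suc (suc d)) → Vec (Sym × Move) (suc (suc d))
prepare (o ∷ i ∷ ss) = (o , stay) ∷ (i , stay) ∷ Vec.map (λ s → s , right) ss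

copy : Vec Sym (suc (suc d)) → Vec (Sym × Move) (suc (suc d))
copy (o ∷ i ∷ ss) = (o , stay) ∷ (i , right) ∷ replicate _ (i , right)

printer : Exp → ∀ d → Prog (suc (suc d))
printer e d =
  act prepare ⨾ while (suc zero) (act copy) (act copy) ⨾
  -- `suc` skips the input tape. The last move puts the output head on the first printed bit, where
  -- `unload` starts.
  compile e suc ⨾ on zero (λ s → s , right)

within-act : ∀ {f ts} → Within {n} (act f) ts 1 (perform f ts)
within-act = 1 , ≤-refl , act

reading : List Sym → List Bool → Tape 0
reading ls []      = tape ls blank []
reading ls (b ∷ v) = tape ls (bit b) (map bit v)

within-copy : ∀ d o ls ls′ v →
  Within (while (suc zero) (act copy) (act copy))
    (o ∷ reading ls v ∷ replicate d (tape ls′ blank [])) (1 + 2 * length v)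
    (o ∷ tape (map bit v ʳ++ ls) blank [] ∷ replicate d (tape (map bit v ʳ++ ls′) blank []))
within-copy d o ls ls′ []      = within-done refl
within-copy d o ls ls′ (b ∷ v) =
  within-≤ (≤-reflexive (arith (length v)))
    (within-loop b refl (body b) (within-copy d o (bit b ∷ ls) (bit b ∷ ls′) v))
  where
  arith : ∀ k → suc (1 + (1 + 2 * k)) ≡ 1 + 2 * suc k
  arith = solve-∀
  shift-reading : ∀ v → shifted right (reading ls (b ∷ v)) ≡ reading (bit b ∷ ls) v
  shift-reading []      = refl
  shift-reading (c ∷ v) = refl
  once : Within (act copy) (o ∷ reading ls (b ∷ v) ∷ replicate d (tape ls′ blank [])) 1
           (o ∷ reading (bit b ∷ ls) v ∷ replicate d (tape (bit b ∷ ls′) blank []))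
  once = within-to
    (cong₂ (λ t us → o ∷ t ∷ us) (shift-reading v)
      (zipWith-replicate writeMove (bit b , right) (tape ls′ blank [])))
    within-act
  body : ∀ c → Within (if c then act copy else act copy)
           (o ∷ reading ls (b ∷ v) ∷ replicate d (tape ls′ blank [])) 1
           (o ∷ reading (bit b ∷ ls) v ∷ replicate d (tape (bit b ∷ ls′) blank []))
  body false = once
  body true  = once

unload-printed : ∀ s → unload (shifted right (printed s)) ≡ s
unload-printed []      = refl
unload-printed (b ∷ s) = bits-map {blank ∷ []} b s
  where
  bits-map : ∀ {ls} b s → unload {0} (tape ls (bit b) (map bit s)) ≡ b ∷ s
  bits-map b []           = refl
  bits-map {ls} b (c ∷ s) = cong (b ∷_) (bits-map {ls} c s)

within-printer : ∀ e w → let d = depth e in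
  ∃ λ ts → Within (printer e d)
    (blankTape ∷ load w ∷ replicate d blankTape)
    (1 + (1 + 2 * length w + (cost e (length w) + 1)))
    (shifted right (printed (str e w)) ∷ ts)
within-printer e w = _ ,
  within-seq (within-to prepared within-act)
  (within-seq (within-copy D blankTape [] (blank ∷ []) w)
  (within-seq
    (within-to (cong (λ s → printed s ∷ i ∷ replicate D (resting w)) (++-identityʳ (str e w)))
      (within-compile e suc w (i ∷ replicate D (resting w)) [] ≤-refl Fin.suc-injective
        (λ k → lookup-replicate k (resting w))))
    (within-to (cong (shifted right (printed (str e w)) ∷_) (perform-idle _)) within-act)))
  where
  D = depth e
  i : Tape 0
  i = tape (map bit w ʳ++ []) blank []
  load-reading : ∀ w → writeMove (Tape.scanned (load w) , stay) (load w) ≡ reading [] w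
  load-reading []      = refl
  load-reading (b ∷ w) = refl
  moved : zipWith writeMove (Vec.map (λ s → s , right) (heads (replicate D blankTape)))
            (replicate D blankTape) ≡ replicate D (tape (blank ∷ []) blank [])
  moved = trans
    (cong (λ ss → zipWith writeMove ss (replicate D blankTape))
      (trans (cong (Vec.map (λ s → s , right)) (map-replicate Tape.scanned blankTape D))
             (map-replicate (λ s → s , right) blank D)))
    (zipWith-replicate writeMove (blank , right) blankTape)
  prepared : perform prepare (blankTape ∷ load w ∷ replicate D blankTape)
             ≡ blankTape ∷ reading [] w ∷ replicate D (tape (blank ∷ []) blank [])
  prepared = cong₂ (λ t us → blankTape ∷ t ∷ us) (load-reading w) moved

_⊕_ : Polynomial → Polynomial → Polynomial
[]       ⊕ q        = q
(c ∷ p)  ⊕ []       = c ∷ p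
(c ∷ p)  ⊕ (c′ ∷ q) = (c + c′) ∷ (p ⊕ q)

⊕-correct : ∀ p q N → ⟦ p ⊕ q ⟧ N ≡ ⟦ p ⟧ N + ⟦ q ⟧ N
⊕-correct []      q        N = refl
⊕-correct (c ∷ p) []       N = sym (+-identityʳ _)
⊕-correct (c ∷ p) (c′ ∷ q) N =
  trans (cong (λ z → c + c′ + N * z) (⊕-correct p q N)) (arith c c′ N (⟦ p ⟧ N) (⟦ q ⟧ N))
  where
  arith : ∀ c c′ N x y → c + c′ + N * (x + y) ≡ c + N * x + (c′ + N * y)
  arith = solve-∀

costᴾ : Exp → Polynomial
costᴾ ε          = 1 ∷ []
costᴾ (bit b)    = 1 ∷ []
costᴾ (e · e′)   = costᴾ e′ ⊕ costᴾ e
costᴾ (each a b) = 4 ∷ ((4 ∷ []) ⊕ (costᴾ a ⊕ costᴾ b))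

costᴾ-correct : ∀ e N → ⟦ costᴾ e ⟧ N ≡ cost e N
costᴾ-correct ε          N = cong suc (*-zeroʳ N)
costᴾ-correct (bit b)    N = cong suc (*-zeroʳ N)
costᴾ-correct (e · e′)   N =
  trans (⊕-correct (costᴾ e′) (costᴾ e) N) (cong₂ _+_ (costᴾ-correct e′ N) (costᴾ-correct e N))
costᴾ-correct (each a b) N =
  trans (cong (λ z → 4 + N * z)
          (trans (⊕-correct (4 ∷ []) (costᴾ a ⊕ costᴾ b) N)
            (cong (λ z → 4 + N * 0 + z)
              (trans (⊕-correct (costᴾ a) (costᴾ b) N)
                (cong₂ _+_ (costᴾ-correct a N) (costᴾ-correct b N))))))
        (arith N (cost a N + cost b N))
  where
  arith : ∀ N c → 4 + N * (4 + N * 0 + c) ≡ 4 + 2 * N + N * (2 + c)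
  arith = solve-∀

str-polyTime : ∀ e → PolyTimeFunction (str e)
-- The summand 3 + 2N pays for `prepare`, the copying loop and the final move.
str-polyTime e = machine (depth e) (printer e (depth e)) , costᴾ e ⊕ (3 ∷ 2 ∷ []) , halts
  where
  time : ∀ N → ⟦ costᴾ e ⊕ (3 ∷ 2 ∷ []) ⟧ (N + 0) ≡ 1 + (1 + 2 * N + (cost e N + 1))
  time N = trans (cong ⟦ costᴾ e ⊕ (3 ∷ 2 ∷ []) ⟧ (+-identityʳ N))
    (trans (⊕-correct (costᴾ e) (3 ∷ 2 ∷ []) N)
      (trans (cong (_+ (3 + N * (2 + N * 0))) (costᴾ-correct e N)) (arith N (cost e N))))
    where
    arith : ∀ N c → c + (3 + N * (2 + N * 0)) ≡ 1 + (1 + 2 * N + (c + 1))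
    arith = solve-∀
  halts : ∀ xs → Machine.HaltsWithin (machine (depth e) (printer e (depth e)))
            (⟦ costᴾ e ⊕ (3 ∷ 2 ∷ []) ⟧ (Vec.sum (Vec.map length xs))) xs _
  halts (w ∷ []) with within-printer e w
  ... | ts , k , h , ex
    with runs⇒run {p = printer e (depth e)} (⟦ costᴾ e ⊕ (3 ∷ 2 ∷ []) ⟧ (length w + 0))
           (exec⇒runs ex) (≤-trans h (≤-reflexive (sym (time (length w)))))
  ... | eq = cong (Machine.step M) eq , trans (cong (Machine.output M) eq) (unload-printed (str e w))
    where
    M = machine (depth e) (printer e (depth e))

-- Gates with untyped references

nth : ∀ {A : Set} → List A → ℕ → Maybe A
nth []       i       = nothing
nth (x ∷ xs) zero    = just x
nth (x ∷ xs) (suc i) = nth xs i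

nth-++ : ∀ {A : Set} (xs : List A) ys i → nth (xs ++ ys) (length xs + i) ≡ nth ys i
nth-++ []       ys i = refl
nth-++ (x ∷ xs) ys i = nth-++ xs ys i

data PreGate (R : Set) : Set where
  cst     : Bool → PreGate R
  inv     : R → PreGate R
  con dis : R → R → PreGate R

mapGate : ∀ {R S : Set} → (R → S) → PreGate R → PreGate S
mapGate f (cst b)   = cst b
mapGate f (inv i)   = inv (f i)
mapGate f (con i j) = con (f i) (f j)
mapGate f (dis i j) = dis (f i) (f j)

mapGate-∘ : ∀ {R S T : Set} {f : S → T} {g : R → S} {h : R → T} → (∀ r → f (g r) ≡ h r) →
            ∀ x → mapGate f (mapGate g x) ≡ mapGate h x
mapGate-∘ eq (cst b)   = refl
mapGate-∘ eq (inv i)   = cong inv (eq i)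
mapGate-∘ eq (con i j) = cong₂ con (eq i) (eq j)
mapGate-∘ eq (dis i j) = cong₂ dis (eq i) (eq j)

-- A relation and not a function: a derivation also certifies that every reference is in range,
-- which is what `typedGate` extracts.
data _⊢_⇓_ (ws : List Bool) : PreGate ℕ → Bool → Set where
  cst : ∀ {b} → ws ⊢ cst b ⇓ b
  inv : ∀ {i a} → nth ws i ≡ just a → ws ⊢ inv i ⇓ not a
  con : ∀ {i j a b} → nth ws i ≡ just a → nth ws j ≡ just b → ws ⊢ con i j ⇓ (a ∧ b)
  dis : ∀ {i j a b} → nth ws i ≡ just a → nth ws j ≡ just b → ws ⊢ dis i j ⇓ (a ∨ b)

infix 4 _⊢_⇓_

⇓-weaken : ∀ us {ws g b} → ws ⊢ g ⇓ b → us ++ ws ⊢ mapGate (length us +_) g ⇓ b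
⇓-weaken us cst       = cst
⇓-weaken us (inv p)   = inv (trans (nth-++ us _ _) p)
⇓-weaken us (con p q) = con (trans (nth-++ us _ _) p) (trans (nth-++ us _ _) q)
⇓-weaken us (dis p q) = dis (trans (nth-++ us _ _) p) (trans (nth-++ us _ _) q)

infixr 5 _∷_

data _⟶[_]_ : List Bool → List (PreGate ℕ) → List Bool → Set where
  []  : ∀ {ws} → ws ⟶[ [] ] ws
  _∷_ : ∀ {ws g gs b us} → ws ⊢ g ⇓ b → (b ∷ ws) ⟶[ gs ] us → ws ⟶[ g ∷ gs ] us

infix 4 _⟶[_]_

infixr 5 _◅◅_

_◅◅_ : ∀ {us gs vs hs ws} → us ⟶[ gs ] vs → vs ⟶[ hs ] ws → us ⟶[ gs ++ hs ] ws
[]      ◅◅ e′ = e′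
(p ∷ e) ◅◅ e′ = p ∷ (e ◅◅ e′)

encodePreGate : PreGate ℕ → List Bool
encodePreGate (cst b)   = false ∷ false ∷ b ∷ []
encodePreGate (inv i)   = false ∷ true  ∷ unary i
encodePreGate (con i j) = true  ∷ false ∷ unary i ++ unary j
encodePreGate (dis i j) = true  ∷ true  ∷ unary i ++ unary j

encodeListed : PreGate ℕ → List Bool
encodeListed g = true ∷ encodePreGate g

lookup-nth : ∀ {k} (v : Vec Bool k) i {b} → nth (toList v) i ≡ just b →
  ∃ λ (j : Fin k) → toℕ j ≡ i ×
    (∀ (v′ : Vec Bool k) {b′} → nth (toList v′) i ≡ just b′ → Vec.lookup v′ j ≡ b′)
lookup-nth (x ∷ v) zero    p = zero , refl , λ { (x′ ∷ v′) refl → refl }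
lookup-nth (x ∷ v) (suc i) p with lookup-nth v i p
... | j , eq , f = suc j , cong suc eq , λ { (x′ ∷ v′) p′ → f v′ p′ }

typedGate : ∀ {k} (v : Vec Bool k) {g b} → toList v ⊢ g ⇓ b →
  ∃ λ (g′ : Gate k) → encodeGate g′ ≡ encodePreGate g ×
    (∀ (v′ : Vec Bool k) {b′} → toList v′ ⊢ g ⇓ b′ → evalGate g′ v′ ≡ b′)
typedGate v (cst {b}) = const b , refl , λ { v′ cst → refl }
typedGate v (inv {i} p) with lookup-nth v i p
... | i′ , refl , f = neg i′ , refl , λ { v′ (inv q) → cong not (f v′ q) }
typedGate v (con {i} {j} p q) with lookup-nth v i p | lookup-nth v j q
... | i′ , refl , f | j′ , refl , g =
  and i′ j′ , refl , λ { v′ (con p q) → cong₂ _∧_ (f v′ p) (g v′ q) }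
typedGate v (dis {i} {j} p q) with lookup-nth v i p | lookup-nth v j q
... | i′ , refl , f | j′ , refl , g =
  or i′ j′ , refl , λ { v′ (dis p q) → cong₂ _∨_ (f v′ p) (g v′ q) }

-- Whether references are in range depends only on the number of wires. Hence the derivation for `v`
-- yields a typed circuit that agrees with the derivations for all other inputs.
typedCircuit : ∀ {k} (v : Vec Bool k) gs {us b} → toList v ⟶[ gs ] us → nth us 0 ≡ just b →
  ∃ λ (C : Circuit k) → encodeBody C ≡ concatMap encodeListed gs ++ false ∷ unary 0 ×
    (∀ (v′ : Vec Bool k) {us′ b′} → toList v′ ⟶[ gs ] us′ → nth us′ 0 ≡ just b′ → eval C v′ ≡ b′)
typedCircuit v [] [] p with lookup-nth v 0 p
... | i , eq , f = result i , cong (λ i → false ∷ unary i) eq , λ { v′ [] q → f v′ q }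
typedCircuit v (g ∷ gs) (_∷_ {b = b} p e) q with typedGate v p | typedCircuit (b ∷ v) gs e q
... | g′ , eq , f | C , eq′ , h =
  gate g′ C ,
  cong (true ∷_) (trans (cong₂ _++_ eq eq′)
    (sym (++-assoc (encodePreGate g) (concatMap encodeListed gs) _))) ,
  λ { v′ (p′ ∷ e′) q′ → trans (cong (λ b → eval C (b ∷ v′)) (f v′ p′))
                           (h (_ ∷ v′) e′ q′) }

-- Unique readability of circuit descriptions

unary-injective : ∀ i j {xs ys} → unary i ++ xs ≡ unary j ++ ys → i ≡ j × xs ≡ ys
unary-injective zero    zero    eq = refl , ∷-injectiveʳ eq
unary-injective (suc i) (suc j) eq with unary-injective i j (∷-injectiveʳ eq)
... | refl , eq′ = refl , eq′

unary-pair-injective : ∀ {k} (i j i′ j′ : Fin k) {xs ys} →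
  (unary (toℕ i) ++ unary (toℕ j)) ++ xs ≡ (unary (toℕ i′) ++ unary (toℕ j′)) ++ ys →
  i ≡ i′ × j ≡ j′ × xs ≡ ys
unary-pair-injective i j i′ j′ {xs} {ys} eq
  with unary-injective (toℕ i) (toℕ i′)
         (trans (sym (++-assoc (unary (toℕ i)) _ _)) (trans eq (++-assoc (unary (toℕ i′)) _ _)))
... | p , eq′ with unary-injective (toℕ j) (toℕ j′) eq′
... | q , eq″ = toℕ-injective p , toℕ-injective q , eq″

-- The arbitrary continuations `xs` and `ys` express prefix-freeness, without which the parts of a
-- concatenation could not be told apart.
encodeGate-injective : ∀ {k} (g h : Gate k) {xs ys} →
  encodeGate g ++ xs ≡ encodeGate h ++ ys → g ≡ h × xs ≡ ys
encodeGate-injective (const b) (const .b) refl = refl , refl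
encodeGate-injective (neg i)   (neg j)    eq
  with unary-injective (toℕ i) (toℕ j) (∷-injectiveʳ (∷-injectiveʳ eq))
... | p , eq′ = cong neg (toℕ-injective p) , eq′
encodeGate-injective (and i j) (and i′ j′) eq
  with unary-pair-injective i j i′ j′ (∷-injectiveʳ (∷-injectiveʳ eq))
... | p , q , eq′ = cong₂ and p q , eq′
encodeGate-injective (or i j)  (or i′ j′) eq
  with unary-pair-injective i j i′ j′ (∷-injectiveʳ (∷-injectiveʳ eq))
... | p , q , eq′ = cong₂ or p q , eq′
encodeGate-injective (const _) (neg _)   ()
encodeGate-injective (const _) (and _ _) ()
encodeGate-injective (const _) (or _ _)  ()
encodeGate-injective (neg _)   (const _) ()
encodeGate-injective (neg _)   (and _ _) ()
encodeGate-injective (neg _)   (or _ _)  ()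
encodeGate-injective (and _ _) (const _) ()
encodeGate-injective (and _ _) (neg _)   ()
encodeGate-injective (and _ _) (or _ _)  ()
encodeGate-injective (or _ _)  (const _) ()
encodeGate-injective (or _ _)  (neg _)   ()
encodeGate-injective (or _ _)  (and _ _) ()

encodeBody-injective : ∀ {k} (C D : Circuit k) → encodeBody C ≡ encodeBody D → C ≡ D
encodeBody-injective (result i) (result j) eq
  with unary-injective (toℕ i) (toℕ j) (cong (_++ []) (∷-injectiveʳ eq))
... | p , _ = cong result (toℕ-injective p)
encodeBody-injective (gate g C) (gate h D) eq with encodeGate-injective g h (∷-injectiveʳ eq)
... | refl , eq′ = cong (gate g) (encodeBody-injective C D eq′)

+-double-injective : ∀ m n → m + m ≡ n + n → m ≡ n
+-double-injective zero    zero    eq = refl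
+-double-injective (suc m) (suc n) eq =
  cong suc (+-double-injective m n
    (suc-injective (trans (sym (+-suc m m)) (trans (suc-injective eq) (+-suc n n)))))

encode-injective : ∀ m n (C : Circuit (m + m)) (D : Circuit (n + n)) → encode C ≡ encode D →
  ∃ λ (eq : m ≡ n) → subst (λ k → Circuit (k + k)) eq C ≡ D
encode-injective m n C D eq with unary-injective (m + m) (n + n) eq
... | p , q with +-double-injective m n p
... | refl = refl , encodeBody-injective C D q

-- Counts and templates of gate lists

-- Numbers depending on N = |w| are kept as syntax, since `repeat` has to turn their sums and
-- products into sequences and nests of loops.
data Count : Set where
  len     : Count
  lit     : ℕ → Count
  _⊞_ _⊠_ : Count → Count → Count

infixl 6 _⊞_
infixl 7 _⊠_

val : Count → ℕ → ℕ
val len     N = N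
val (lit k) N = k
val (a ⊞ b) N = val a N + val b N
val (a ⊠ b) N = val a N * val b N

horner : Polynomial → Count → Count
horner []       x = lit 0
horner (c ∷ cs) x = lit c ⊞ x ⊠ horner cs x

horner-correct : ∀ p x N → val (horner p x) N ≡ ⟦ p ⟧ (val x N)
horner-correct []       x N = refl
horner-correct (c ∷ cs) x N = cong (λ z → c + val x N * z) (horner-correct cs x N)

-- New copies go to the end, as in `revConcat`, and as in `emit`, where the last gate computes the
-- first component.
pow : ∀ {A : Set} → ℕ → List A → List A
pow zero    xs = []
pow (suc n) xs = pow n xs ++ xs

pow-+ : ∀ {A : Set} a b (xs : List A) → pow (a + b) xs ≡ pow a xs ++ pow b xs
pow-+ a zero    xs = trans (cong (λ n → pow n xs) (+-identityʳ a)) (sym (++-identityʳ _))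
pow-+ a (suc b) xs = trans (cong (λ n → pow n xs) (+-suc a b))
  (trans (cong (_++ xs) (pow-+ a b xs)) (++-assoc (pow a xs) (pow b xs) xs))

pow-* : ∀ {A : Set} a b (xs : List A) → pow (a * b) xs ≡ pow a (pow b xs)
pow-* zero    b xs = refl
pow-* (suc a) b xs = trans (cong (λ n → pow n xs) (+-comm b (a * b)))
  (trans (pow-+ (a * b) b xs) (cong (_++ pow b xs) (pow-* a b xs)))

repeatLit : ℕ → Exp → Exp
repeatLit zero    e = ε
repeatLit (suc k) e = repeatLit k e · e

repeat : Count → Exp → Exp
repeat len     e = each e e
repeat (lit k) e = repeatLit k e
repeat (a ⊞ b) e = repeat a e · repeat b e
repeat (a ⊠ b) e = repeat a (repeat b e)

str-repeat : ∀ c e w → str (repeat c e) w ≡ pow (val c (length w)) (str e w)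
str-repeat len e w = go w
  where
  same : ∀ c → (if c then str e w else str e w) ≡ str e w
  same false = refl
  same true  = refl
  go : ∀ v → revConcat (λ c → if c then str e w else str e w) v ≡ pow (length v) (str e w)
  go []      = refl
  go (c ∷ v) = cong₂ _++_ (go v) (same c)
str-repeat (lit k) e w = go k
  where
  go : ∀ k → str (repeatLit k e) w ≡ pow k (str e w)
  go zero    = refl
  go (suc k) = cong (_++ str e w) (go k)
str-repeat (a ⊞ b) e w = trans (cong₂ _++_ (str-repeat a e w) (str-repeat b e w))
  (sym (pow-+ (val a (length w)) (val b (length w)) (str e w)))
str-repeat (a ⊠ b) e w = trans (str-repeat a (repeat b e) w)
  (trans (cong (pow (val a (length w))) (str-repeat b e w))
    (sym (pow-* (val a (length w)) (val b (length w)) (str e w))))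

unaryᴱ : Count → Exp
unaryᴱ c = repeat c (bit true) · bit false

str-unaryᴱ : ∀ c w → str (unaryᴱ c) w ≡ unary (val c (length w))
str-unaryᴱ c w = cong (_++ false ∷ [])
  (trans (str-repeat c (bit true) w) (go (val c (length w))))
  where
  snoc : ∀ n → List.replicate n true ++ true ∷ [] ≡ true ∷ List.replicate n true
  snoc zero    = refl
  snoc (suc n) = cong (true ∷_) (snoc n)
  go : ∀ n → pow n (true ∷ []) ≡ List.replicate n true
  go zero    = refl
  go (suc n) = trans (cong (_++ true ∷ []) (go n)) (snoc n)

gateᴱ : PreGate Count → Exp
gateᴱ (cst b)   = bit false · bit false · bit b
gateᴱ (inv i)   = bit false · bit true  · unaryᴱ i
gateᴱ (con i j) = bit true  · bit false · unaryᴱ i · unaryᴱ j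
gateᴱ (dis i j) = bit true  · bit true  · unaryᴱ i · unaryᴱ j

gateAt : List Bool → PreGate Count → PreGate ℕ
gateAt w = mapGate (λ c → val c (length w))

str-gateᴱ : ∀ g w → str (gateᴱ g) w ≡ encodePreGate (gateAt w g)
str-gateᴱ (cst b)   w = refl
str-gateᴱ (inv i)   w = cong (λ s → false ∷ true ∷ s) (str-unaryᴱ i w)
str-gateᴱ (con i j) w =
  cong₂ (λ s t → true ∷ false ∷ s ++ t) (str-unaryᴱ i w) (str-unaryᴱ j w)
str-gateᴱ (dis i j) w =
  cong₂ (λ s t → true ∷ true ∷ s ++ t) (str-unaryᴱ i w) (str-unaryᴱ j w)

data Template : Set where
  skip  : Template
  one   : PreGate Count → Template
  _▸_   : Template → Template → Template
  times : Count → Template → Template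
  -- One template per bit of the input word, starting with its last bit.
  read  : Template → Template → Template

infixr 5 _▸_

gates : Template → List Bool → List (PreGate ℕ)
gates skip        w = []
gates (one g)     w = gateAt w g ∷ []
gates (s ▸ t)     w = gates s w ++ gates t w
gates (times c t) w = pow (val c (length w)) (gates t w)
gates (read s t)  w = revConcat (λ b → if b then gates t w else gates s w) w

templateᴱ : Template → Exp
templateᴱ skip        = ε
templateᴱ (one g)     = bit true · gateᴱ g
templateᴱ (s ▸ t)     = templateᴱ s · templateᴱ t
templateᴱ (times c t) = repeat c (templateᴱ t)
templateᴱ (read s t)  = each (templateᴱ s) (templateᴱ t)

concatMap-++ : ∀ {A B : Set} (f : A → List B) xs ys →
               concatMap f (xs ++ ys) ≡ concatMap f xs ++ concatMap f ys
concatMap-++ f []       ys = refl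
concatMap-++ f (x ∷ xs) ys =
  trans (cong (f x ++_) (concatMap-++ f xs ys)) (sym (++-assoc (f x) _ _))

concatMap-pow : ∀ {A B : Set} (f : A → List B) n xs →
                concatMap f (pow n xs) ≡ pow n (concatMap f xs)
concatMap-pow f zero    xs = refl
concatMap-pow f (suc n) xs =
  trans (concatMap-++ f (pow n xs) xs) (cong (_++ concatMap f xs) (concatMap-pow f n xs))

str-templateᴱ : ∀ t w → str (templateᴱ t) w ≡ concatMap encodeListed (gates t w)
str-templateᴱ skip    w = refl
str-templateᴱ (one g) w = cong (true ∷_) (trans (str-gateᴱ g w) (sym (++-identityʳ _)))
str-templateᴱ (s ▸ t) w = trans (cong₂ _++_ (str-templateᴱ s w) (str-templateᴱ t w))
  (sym (concatMap-++ encodeListed (gates s w) (gates t w)))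
str-templateᴱ (times c t) w = trans (str-repeat c (templateᴱ t) w)
  (trans (cong (pow (val c (length w))) (str-templateᴱ t w))
    (sym (concatMap-pow encodeListed (val c (length w)) (gates t w))))
str-templateᴱ (read s t) w = go w
  where
  one-bit : ∀ b → (if b then str (templateᴱ t) w else str (templateᴱ s) w)
            ≡ concatMap encodeListed (if b then gates t w else gates s w)
  one-bit false = str-templateᴱ s w
  one-bit true  = str-templateᴱ t w
  go : ∀ v → revConcat (λ b → if b then str (templateᴱ t) w else str (templateᴱ s) w) v
       ≡ concatMap encodeListed (revConcat (λ b → if b then gates t w else gates s w) v)
  go []      = refl
  go (b ∷ v) = trans (cong₂ _++_ (go v) (one-bit b))
    (sym (concatMap-++ encodeListed (revConcat _ v) _))

nth-length : ∀ {A : Set} (js : List A) {ps x v l} → length js ≡ l →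
             nth ps x ≡ just v → nth (js ++ ps) (l + x) ≡ just v
nth-length js refl p = trans (nth-++ js _ _) p

-- Vectors of consecutive wires

At : List Bool → ℕ → Vec Bool k → Set
At ws i []       = ⊤
At ws i (a ∷ as) = nth ws i ≡ just a × At ws (suc i) as

at-∷ : ∀ b {ws i} (as : Vec Bool k) → At ws i as → At (b ∷ ws) (suc i) as
at-∷ b []       tt      = tt
at-∷ b (a ∷ as) (p , q) = p , at-∷ b as q

at-++ : ∀ (us : Vec Bool m) {ws i} (as : Vec Bool k) → At ws i as → At (toList us ++ ws) (m + i) as
at-++ []       as p = p
at-++ (u ∷ us) as p = at-∷ u as (at-++ us as p)

at-front : ∀ (as : Vec Bool k) ws → At (toList as ++ ws) 0 as
at-front []       ws = tt
at-front (a ∷ as) ws = refl , at-∷ a as (at-front as ws)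

Lanes : List Bool → PreGate ℕ → Vec Bool k → Set
Lanes ws g []       = ⊤
Lanes ws g (v ∷ vs) = ws ⊢ g ⇓ v × Lanes ws (mapGate suc g) vs

-- The gates offer no identity; the conjunction of a wire with itself serves as one.
copyOf : ∀ {R : Set} → R → PreGate R
copyOf r = con r r

copy⇓ : ∀ {ws i a} → nth ws i ≡ just a → ws ⊢ copyOf i ⇓ a
copy⇓ {ws} {i} {a} p = subst (ws ⊢ copyOf i ⇓_) (Bool.∧-idem a) (con p p)

lanes-copy : ∀ {ws i} (as : Vec Bool k) → At ws i as → Lanes ws (copyOf i) as
lanes-copy []       tt      = tt
lanes-copy (a ∷ as) (p , q) = copy⇓ p , lanes-copy as q

module _ {C : Set} {ws : List Bool} where

  lanes-cst : ∀ b (cs : Vec C k) → Lanes ws (cst b) (Vec.map (λ _ → b) cs)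
  lanes-cst b []       = tt
  lanes-cst b (c ∷ cs) = cst , lanes-cst b cs

  lanes-inv : ∀ {i} f (cs : Vec C k) → At ws i (Vec.map f cs) →
              Lanes ws (inv i) (Vec.map (not ∘ f) cs)
  lanes-inv f []       p       = tt
  lanes-inv f (c ∷ cs) (p , q) = inv p , lanes-inv f cs q

  lanes-con : ∀ {i j} f h (cs : Vec C k) → At ws i (Vec.map f cs) → At ws j (Vec.map h cs) →
              Lanes ws (con i j) (Vec.map (λ c → f c ∧ h c) cs)
  lanes-con f h []       p       p′        = tt
  lanes-con f h (c ∷ cs) (p , q) (p′ , q′) = con p p′ , lanes-con f h cs q q′

  lanes-dis : ∀ {i j} f h (cs : Vec C k) → At ws i (Vec.map f cs) → At ws j (Vec.map h cs) →
              Lanes ws (dis i j) (Vec.map (λ c → f c ∨ h c) cs)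
  lanes-dis f h []       p       p′        = tt
  lanes-dis f h (c ∷ cs) (p , q) (p′ , q′) = dis p p′ , lanes-dis f h cs q q′

⇓-weakenᵛ : ∀ (us : Vec Bool k) {ws g b} → ws ⊢ g ⇓ b → toList us ++ ws ⊢ mapGate (k +_) g ⇓ b
⇓-weakenᵛ us {ws} {g} {b} p =
  subst (λ l → toList us ++ ws ⊢ mapGate (l +_) g ⇓ b) (length-toList us) (⇓-weaken (toList us) p)

-- Every new wire shifts the references by one, so that a repeated gate
-- moves along the vectors it reads, from their last component to the first.
emit : ∀ {ws} g (vs : Vec Bool k) → Lanes ws (mapGate suc g) vs →
       ws ⟶[ pow k (mapGate (k +_) g ∷ []) ] (toList vs ++ ws)
emit g []                       tt       = []
emit {suc k} {ws} g (v ∷ vs) (p , ps) =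
  subst (λ h → ws ⟶[ pow k (h ∷ []) ++ h ∷ [] ] _)
    (mapGate-∘ (λ r → +-suc k r) g)
    (emit (mapGate suc g) vs ps ◅◅ (⇓-weakenᵛ vs p ∷ []))

-- A vector of length `suc k` takes the offset `k`: its first component is emitted last, after `k`
-- new wires. `emit` phrases this with references one lower, which admits the empty vector.
emit⁺ : ∀ {ws} g (vs : Vec Bool (suc k)) → Lanes ws g vs →
        ws ⟶[ pow (suc k) (mapGate (k +_) g ∷ []) ] (toList vs ++ ws)
emit⁺ g (v ∷ vs) (p , ps) = emit g vs ps ◅◅ (⇓-weakenᵛ vs p ∷ [])

shiftIn : ∀ {A : Set} → A → Vec A k → Vec A k
shiftIn x []       = []
shiftIn x (a ∷ as) = x ∷ shiftIn a as

shiftOut : ∀ {A : Set} → Vec A k → A → Vec A k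
shiftOut []       x = []
shiftOut (a ∷ as) x = as ∷ʳ x

map-shiftIn : ∀ {A B : Set} (f : A → B) x (as : Vec A k) →
              Vec.map f (shiftIn x as) ≡ shiftIn (f x) (Vec.map f as)
map-shiftIn f x []       = refl
map-shiftIn f x (a ∷ as) = cong (f x ∷_) (map-shiftIn f a as)

map-shiftOut : ∀ {A B : Set} (f : A → B) (as : Vec A k) x →
               Vec.map f (shiftOut as x) ≡ shiftOut (Vec.map f as) (f x)
map-shiftOut f []       x = refl
map-shiftOut f (a ∷ as) x = go as
  where
  go : ∀ {k} (as : Vec _ k) → Vec.map f (as ∷ʳ x) ≡ Vec.map f as ∷ʳ f x
  go []       = refl
  go (a ∷ as) = cong (f a ∷_) (go as)

at-shiftIn : ∀ {ws i} a (as : Vec Bool k) → At ws i (a ∷ as) → At ws i (shiftIn a as)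
at-shiftIn a []       p       = tt
at-shiftIn a (b ∷ as) (p , q) = p , at-shiftIn b as q

toList-∷ʳ : ∀ (as : Vec Bool k) b ws → toList (as ∷ʳ b) ++ ws ≡ toList as ++ b ∷ ws
toList-∷ʳ []       b ws = refl
toList-∷ʳ (a ∷ as) b ws = cong (a ∷_) (toList-∷ʳ as b ws)

-- Templates acting on all cells at once

front : ∀ k → Vec ℕ k
front zero    = []
front (suc k) = 0 ∷ Vec.map suc (front k)

-- The number of vectors added by a Shannon expansion in k variables.
size : ℕ → ℕ
size zero    = 1
size (suc k) = 4 + (size k + size k)

every : ℕ → ∀ m → Vec ℕ m
every s zero    = []
every s (suc m) = 0 ∷ Vec.map (s +_) (every s m)

module Rows (W₂ : Count) where

  -- A gate repeated `W` or `W₁` times has its references offset by one less, that is by `W₁` or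
  -- `W₂`. Building upwards from `W₂` avoids subtraction.
  W₁ W : Count
  W₁ = lit 1 ⊞ W₂
  W  = lit 1 ⊞ W₁

  repeated : Count → PreGate Count → Template
  repeated c g = times c (one g)

  lanewise : PreGate ℕ → Template
  lanewise g = repeated W (mapGate (λ r → W₁ ⊞ lit r ⊠ W) g)

  spread fromLeft fromRight duplicate : ℕ → Template
  spread r    = one (copyOf (lit r ⊠ W)) ▸ repeated W₁ (copyOf (lit 0))
  fromLeft r  = repeated W₁ (copyOf (W₂ ⊞ lit r ⊠ W)) ▸ one (cst false)
  -- Of the 2, one skips the first component, which is shifted out, and one the new wire carrying
  -- `false`.
  fromRight r = one (cst false) ▸ repeated W₁ (copyOf (W₂ ⊞ (lit 2 ⊞ lit r ⊠ W)))
  duplicate r = lanewise (copyOf r)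

  -- The multiplexer (f₁ ∧ x) ∨ (¬ x ∧ f₀), where f₁ and f₀ are f with its first argument set to
  -- true and false. The size is exponential in k, but k never depends on w. In the references, `s`
  -- steps over the block of f₀, `s + s` over both blocks, and 2 over the two planes added after
  -- them.
  shannon : (Vec Bool k → Bool) → Vec ℕ k → Template
  shannon {zero}  f []       = lanewise (cst (f []))
  shannon {suc k} f (x ∷ xs) =
    shannon (λ c → f (true ∷ c)) xs ▸
    shannon (λ c → f (false ∷ c)) (Vec.map (s +_) xs) ▸
    lanewise (inv (s + (s + x))) ▸
    lanewise (con 0 1) ▸
    lanewise (con (2 + s) (2 + (s + (s + x)))) ▸
    lanewise (dis 0 1)
    where s = size k

  shannons : Vec (Vec Bool k → Bool) m → Vec ℕ k → Template
  shannons []                   xs = skip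
  shannons {k} {suc m} (f ∷ fs) xs = shannons fs xs ▸ shannon f (Vec.map (m * size k +_) xs)

  applyAll : (ℕ → Template) → Vec ℕ m → Template
  applyAll op []               = skip
  applyAll {suc m} op (x ∷ xs) = applyAll op xs ▸ op (m + x)

  components : (Vec Bool k → Vec Bool m) → Vec (Vec Bool k → Bool) m
  components F = Vec.tabulate λ i c → lookup (F c) i

  neighbours : ∀ k → Vec ℕ (k + (k + (k + k)))
  neighbours k = front k Vec.++ Vec.map (k +_) (front k Vec.++ Vec.map (k +_)
                   (front k Vec.++ Vec.map (k +_) (front k)))

  -- The m results lie a fixed distance apart, with intermediate planes between them. Duplicating
  -- them yields one block on top, the layout that the next update expects.
  rowTemplate : ∀ k → (Vec Bool (k + (k + (k + k))) → Vec Bool m) → Template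
  rowTemplate {m} k F =
    applyAll spread (front k) ▸
    applyAll fromLeft (Vec.map (k +_) (front k)) ▸
    applyAll fromRight (Vec.map (k +_) (Vec.map (k +_) (front k))) ▸
    shannons (components F) (neighbours k) ▸
    applyAll duplicate (every (size (k + (k + (k + k)))) m)

  module Correct (w : List Bool) where

    ℓ₂ ℓ₁ ℓ : ℕ
    ℓ₂ = val W₂ (length w)
    ℓ₁ = suc ℓ₂
    ℓ  = suc ℓ₁

    Plane : Set
    Plane = Vec Bool ℓ

    wires : List Plane → List Bool → List Bool
    wires []       rest = rest
    wires (p ∷ ps) rest = toList p ++ wires ps rest

    -- Quantifying over the wires `rest` below the planes expresses that a template neither reads
    -- nor changes them.
    record _⟹[_]_ (ps : List Plane) (t : Template) (qs : List Plane) : Set where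
      constructor ⟨_⟩
      field
        steps : ∀ rest → wires ps rest ⟶[ gates t w ] wires qs rest

    open _⟹[_]_ public

    infix 4 _⟹[_]_

    _▹_ : ∀ {ps s qs t rs} → ps ⟹[ s ] qs → qs ⟹[ t ] rs → ps ⟹[ s ▸ t ] rs
    e ▹ e′ = ⟨ (λ rest → steps e rest ◅◅ steps e′ rest) ⟩

    infixr 5 _▹_

    at-plane : ∀ ps r {v rest} → nth ps r ≡ just v → At (wires ps rest) (r * ℓ) v
    at-plane (p ∷ ps) zero    refl = at-front p _
    at-plane (p ∷ ps) (suc r) eq   = at-++ p _ (at-plane ps r eq)

    -- References count planes here; multiplied by `ℓ` they refer to the wires of the first lane.
    data Denotes {C : Set} (cs : Vec C ℓ) (ps : List Plane) : PreGate ℕ → (C → Bool) → Set where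
      cst : ∀ b → Denotes cs ps (cst b) (λ _ → b)
      inv : ∀ {r f} → nth ps r ≡ just (Vec.map f cs) → Denotes cs ps (inv r) (not ∘ f)
      con : ∀ {r s f h} → nth ps r ≡ just (Vec.map f cs) → nth ps s ≡ just (Vec.map h cs) →
            Denotes cs ps (con r s) (λ c → f c ∧ h c)
      dis : ∀ {r s f h} → nth ps r ≡ just (Vec.map f cs) → nth ps s ≡ just (Vec.map h cs) →
            Denotes cs ps (dis r s) (λ c → f c ∨ h c)

    denotes-lanes : ∀ {C : Set} {cs : Vec C ℓ} {ps g f} rest → Denotes cs ps g f →
                    Lanes (wires ps rest) (mapGate (_* ℓ) g) (Vec.map f cs)
    denotes-lanes {cs = cs} rest (cst b)   = lanes-cst b cs
    denotes-lanes {cs = cs} {ps} rest (inv {r} p) = lanes-inv _ cs (at-plane ps r {rest = rest} p)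
    denotes-lanes {cs = cs} {ps} rest (con {r} {s} p q) =
      lanes-con _ _ cs (at-plane ps r {rest = rest} p) (at-plane ps s {rest = rest} q)
    denotes-lanes {cs = cs} {ps} rest (dis {r} {s} p q) =
      lanes-dis _ _ cs (at-plane ps r {rest = rest} p) (at-plane ps s {rest = rest} q)

    run-lanewise : ∀ {C : Set} {cs : Vec C ℓ} {ps g f} → Denotes cs ps g f →
                   ps ⟹[ lanewise g ] Vec.map f cs ∷ ps
    run-lanewise {cs = cs} {ps} {g} {f} d = ⟨_⟩ λ rest →
      subst (λ h → wires ps rest ⟶[ pow ℓ (h ∷ []) ] (toList (Vec.map f cs) ++ wires ps rest))
        (trans (mapGate-∘ (λ _ → refl) g) (sym (mapGate-∘ (λ _ → refl) g)))
        (emit⁺ (mapGate (_* ℓ) g) (Vec.map f cs) (denotes-lanes rest d))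

    Implements : (ℕ → Template) → (Plane → Plane) → Set
    Implements op h = ∀ {ps x v} → nth ps x ≡ just v → ps ⟹[ op x ] h v ∷ ps

    run-duplicate : Implements duplicate (λ v → v)
    run-duplicate {ps} {x} {v} p = ⟨_⟩ λ rest →
      emit⁺ (copyOf (x * ℓ)) v (lanes-copy v (at-plane ps x p))

    run-spread : Implements spread (λ v → Vec.replicate ℓ (Vec.head v))
    run-spread {ps} {x} {a ∷ v} p = ⟨_⟩ λ rest →
      copy⇓ (proj₁ (at-plane ps x p)) ∷
      subst (λ us → a ∷ wires ps rest ⟶[ pow ℓ₁ (copyOf 0 ∷ []) ] us)
            (snoc ℓ₁ (wires ps rest)) (go ℓ₁)
      where
      go : ∀ {ws} j → a ∷ ws ⟶[ pow j (copyOf 0 ∷ []) ] toList (Vec.replicate j a) ++ a ∷ ws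
      go zero          = []
      go (suc zero)    = copy⇓ refl ∷ []
      go (suc (suc j)) = go (suc j) ◅◅ (copy⇓ refl ∷ [])
      snoc : ∀ j ws → toList (Vec.replicate j a) ++ a ∷ ws ≡ a ∷ toList (Vec.replicate j a) ++ ws
      snoc zero    ws = refl
      snoc (suc j) ws = cong (a ∷_) (snoc j ws)

    run-fromLeft : Implements fromLeft (shiftIn false)
    run-fromLeft {ps} {x} {a ∷ v} p = ⟨_⟩ λ rest →
      emit⁺ (copyOf (x * ℓ)) (shiftIn a v)
        (lanes-copy (shiftIn a v) (at-shiftIn a v (at-plane ps x p)))
      ◅◅ (cst ∷ [])

    run-fromRight : Implements fromRight (λ v → shiftOut v false)
    run-fromRight {ps} {x} {a ∷ v} p = ⟨_⟩ λ rest →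
      cst ∷
      subst (λ us → false ∷ wires ps rest ⟶[ _ ] us) (sym (toList-∷ʳ v false (wires ps rest)))
        (emit⁺ (copyOf (2 + x * ℓ)) v
          (lanes-copy v (at-∷ false v (proj₂ (at-plane ps x p)))))

    -- The i-th named plane consists of the i-th bits of the rows.
    record Holds (ps : List Plane) (xs : Vec ℕ k) (row : Vec (Vec Bool k) ℓ) : Set where
      constructor holds
      field
        plane : ∀ i → nth ps (lookup xs i) ≡ just (Vec.map (λ c → lookup c i) row)

    open Holds public

    holds-weaken : ∀ js {l ps} {xs : Vec ℕ k} {row} → length js ≡ l →
                   Holds ps xs row → Holds (js ++ ps) (Vec.map (l +_) xs) row
    holds-weaken js {l} {ps} {xs} eq h = holds λ i →
      trans (cong (nth (js ++ ps)) (lookup-map i (l +_) xs)) (nth-length js eq (plane h i))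

    holds-++ : ∀ {ps} (xs : Vec ℕ k) (ys : Vec ℕ m) {row row′} →
               Holds ps xs row → Holds ps ys row′ →
               Holds ps (xs Vec.++ ys) (Vec.zipWith Vec._++_ row row′)
    holds-++ {k} {m} {ps} xs ys {row} {row′} h h′ = holds λ i →
      trans (cong (nth ps) (lookup-splitAt k xs ys i))
        (trans (pick (splitAt k i)) (cong just (sym (column i row row′))))
      where
      pick : ∀ s → nth ps ([ lookup xs , lookup ys ]′ s)
             ≡ just (Vec.zipWith (λ c c′ → [ lookup c , lookup c′ ]′ s) row row′)
      pick (inj₁ j) = trans (plane h j) (cong just (zip₁ row row′))
        where
        zip₁ : ∀ {l} (r : Vec (Vec Bool k) l) (r′ : Vec (Vec Bool m) l) →
               Vec.map (λ c → lookup c j) r ≡ Vec.zipWith (λ c c′ → lookup c j) r r′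
        zip₁ []      []        = refl
        zip₁ (c ∷ r) (c′ ∷ r′) = cong (_ ∷_) (zip₁ r r′)
      pick (inj₂ j) = trans (plane h′ j) (cong just (zip₂ row row′))
        where
        zip₂ : ∀ {l} (r : Vec (Vec Bool k) l) (r′ : Vec (Vec Bool m) l) →
               Vec.map (λ c → lookup c j) r′ ≡ Vec.zipWith (λ c c′ → lookup c′ j) r r′
        zip₂ []      []        = refl
        zip₂ (c ∷ r) (c′ ∷ r′) = cong (_ ∷_) (zip₂ r r′)
      column : ∀ i {l} (r : Vec (Vec Bool k) l) (r′ : Vec (Vec Bool m) l) →
               Vec.map (λ c → lookup c i) (Vec.zipWith Vec._++_ r r′)
               ≡ Vec.zipWith (λ c c′ → [ lookup c , lookup c′ ]′ (splitAt k i)) r r′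
      column i []      []        = refl
      column i (c ∷ r) (c′ ∷ r′) = cong₂ _∷_ (lookup-splitAt k c c′ i) (column i r r′)

    holds-tail : ∀ {ps x} {xs : Vec ℕ k} {row} →
                 Holds ps (x ∷ xs) row → Holds ps xs (Vec.map Vec.tail row)
    holds-tail {row = row} h = holds λ i → trans (plane h (suc i)) (cong just
      (trans (map-cong (λ { (b ∷ c) → refl }) row) (map-∘ (λ c → lookup c i) Vec.tail row)))

    -- The intermediate planes `js` stay on the stack. Their number depends on k only, so that later
    -- references can step over them.
    run-shannon : ∀ (f : Vec Bool k → Bool) {ps} (xs : Vec ℕ k) {row} → Holds ps xs row →
      ∃ λ js → suc (length js) ≡ size k × ps ⟹[ shannon f xs ] Vec.map f row ∷ js ++ ps
    run-shannon {zero} f {ps} [] {row} h = [] , refl ,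
      subst (λ v → ps ⟹[ shannon f [] ] v ∷ ps)
        (map-cong (λ { [] → refl }) row) (run-lanewise {cs = row} (cst (f [])))
    run-shannon {suc k} f {ps} (x ∷ xs) {row} h
      with run-shannon (λ c → f (true ∷ c)) xs (holds-tail {x = x} {xs} h)
    ... | js , eq , e
      with run-shannon (λ c → f (false ∷ c)) (Vec.map (size k +_) xs)
             (holds-weaken (_ ∷ js) eq (holds-tail {x = x} {xs} h))
    ... | js′ , eq′ , e′ =
      V₂ ∷ V₁ ∷ V₀ ∷ B ∷ js′ ++ A ∷ js , count ,
      subst (λ qs → ps ⟹[ shannon f (x ∷ xs) ] qs) final
        (e ▹ e′ ▹
         run-lanewise (inv {f = hd} (at-x [] refl)) ▹
         run-lanewise (con {f = λ c → not (hd c)} {h = fb} refl (cong just B≡)) ▹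
         run-lanewise (con {f = fa} {h = hd} at-A (at-x (V₁ ∷ V₀ ∷ []) refl)) ▹
         run-lanewise (dis {f = λ c → fa c ∧ hd c} {h = λ c → not (hd c) ∧ fb c} refl refl))
      where
      s = size k
      hd fa fb mux : Vec Bool (suc k) → Bool
      hd c  = lookup c zero
      fa c  = f (true ∷ Vec.tail c)
      fb c  = f (false ∷ Vec.tail c)
      mux c = (fa c ∧ hd c) ∨ (not (hd c) ∧ fb c)
      A B V₀ V₁ V₂ : Plane
      A  = Vec.map (λ c → f (true ∷ c)) (Vec.map Vec.tail row)
      B  = Vec.map (λ c → f (false ∷ c)) (Vec.map Vec.tail row)
      V₀ = Vec.map (λ c → not (hd c)) row
      V₁ = Vec.map (λ c → not (hd c) ∧ fb c) row
      V₂ = Vec.map (λ c → fa c ∧ hd c) row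
      A≡ : A ≡ Vec.map fa row
      A≡ = sym (map-∘ _ Vec.tail row)
      B≡ : B ≡ Vec.map fb row
      B≡ = sym (map-∘ _ Vec.tail row)
      qs : List Plane
      qs = B ∷ js′ ++ A ∷ js ++ ps
      at-A : nth (V₁ ∷ V₀ ∷ qs) (2 + s) ≡ just (Vec.map fa row)
      at-A = subst (λ l → nth qs l ≡ just (Vec.map fa row)) (+-identityʳ s)
               (nth-length (B ∷ js′) eq′ (cong just A≡))
      at-x : ∀ us {l} → length us ≡ l → nth (us ++ qs) (l + (s + (s + x))) ≡ just (Vec.map hd row)
      at-x us eq₀ = nth-length us eq₀ (nth-length (B ∷ js′) eq′ (nth-length (A ∷ js) eq (plane h zero)))
      count : 4 + suc (length (js′ ++ A ∷ js)) ≡ 4 + (s + s)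
      count = cong (4 +_) (trans (cong suc (length-++ js′)) (cong₂ _+_ eq′ eq))
      mux-correct : ∀ c → mux c ≡ f c
      mux-correct (true  ∷ c) = trans (Bool.∨-identityʳ _) (Bool.∧-identityʳ _)
      mux-correct (false ∷ c) = cong (_∨ f (false ∷ c)) (Bool.∧-zeroʳ (f (true ∷ c)))
      final : Vec.map mux row ∷ V₂ ∷ V₁ ∷ V₀ ∷ qs
              ≡ Vec.map f row ∷ V₂ ∷ V₁ ∷ V₀ ∷ (B ∷ js′ ++ A ∷ js) ++ ps
      final = cong₂ (λ v us → v ∷ V₂ ∷ V₁ ∷ V₀ ∷ B ∷ us) (map-cong mux-correct row)
                (sym (++-assoc js′ (A ∷ js) ps))

    run-shannons : ∀ (fs : Vec (Vec Bool k → Bool) m) {ps} (xs : Vec ℕ k) {row} → Holds ps xs row →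
      ∃ λ js → length js ≡ m * size k × ps ⟹[ shannons fs xs ] js ++ ps ×
        (∀ i → nth (js ++ ps) (lookup (every (size k) m) i) ≡ just (Vec.map (lookup fs i) row))
    run-shannons [] xs h = [] , refl , ⟨ (λ rest → []) ⟩ , λ ()
    run-shannons {k} {suc m} (f ∷ fs) {ps} xs {row} h with run-shannons fs xs h
    ... | js , eq , e , at
      with run-shannon f (Vec.map (m * size k +_) xs) (holds-weaken js eq h)
    ... | js′ , eq′ , e′ =
      Vec.map f row ∷ js′ ++ js ,
      trans (cong suc (length-++ js′)) (cong₂ _+_ eq′ eq) ,
      subst (λ us → ps ⟹[ shannons (f ∷ fs) xs ] Vec.map f row ∷ us)
        (sym (++-assoc js′ js ps)) (e ▹ e′) ,
      λ { zero    → refl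
        ; (suc i) → trans
            (cong (nth (Vec.map f row ∷ (js′ ++ js) ++ ps)) (lookup-map i (size k +_) (every (size k) m)))
            (subst (λ us → nth (Vec.map f row ∷ us) (size k + lookup (every (size k) m) i)
                           ≡ just (Vec.map (lookup fs i) row))
              (sym (++-assoc js′ js ps))
              (nth-length (Vec.map f row ∷ js′) eq′ (at i))) }

    run-applyAll : ∀ {op h} → Implements op h → ∀ {ps} (xs : Vec ℕ m) (vs : Fin m → Plane) →
      (∀ i → nth ps (lookup xs i) ≡ just (vs i)) →
      ∃ λ js → length js ≡ m × ps ⟹[ applyAll op xs ] js ++ ps ×
        (∀ i → nth (js ++ ps) (lookup (front m) i) ≡ just (h (vs i)))
    run-applyAll imp [] vs at = [] , refl , ⟨ (λ rest → []) ⟩ , λ ()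
    run-applyAll {suc m} {h = h} imp {ps} (x ∷ xs) vs at
      with run-applyAll imp xs (vs ∘ suc) (at ∘ suc)
    ... | js , eq , e , at′ =
      h (vs zero) ∷ js , cong suc eq , (e ▹ imp (nth-length js eq (at zero))) ,
      λ { zero    → refl
        ; (suc i) → trans (cong (nth (h (vs zero) ∷ js ++ ps)) (lookup-map i suc (front m))) (at′ i) }

    falses : Vec Bool k
    falses = Vec.replicate _ false

    neighbourhoods : Vec (Vec Bool k) ℓ → Vec (Vec Bool (k + (k + (k + k)))) ℓ
    neighbourhoods row =
      Vec.zipWith Vec._++_ (shiftOut row falses)
        (Vec.zipWith Vec._++_ (shiftIn falses row)
          (Vec.zipWith Vec._++_ (Vec.replicate ℓ (Vec.head row)) row))

    module _ {ps : List Plane} {row : Vec (Vec Bool k) ℓ} where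

      holds-head : (∀ i → nth ps (lookup (front k) i) ≡
                     just (Vec.replicate ℓ (Vec.head (Vec.map (λ c → lookup c i) row)))) →
                   Holds ps (front k) (Vec.replicate ℓ (Vec.head row))
      holds-head at = holds λ i → trans (at i) (cong just
        (trans (cong (Vec.replicate ℓ) (go i row))
               (sym (map-replicate (λ c → lookup c i) (Vec.head row) ℓ))))
        where
        go : ∀ i {l} (r : Vec (Vec Bool k) (suc l)) →
             Vec.head (Vec.map (λ c → lookup c i) r) ≡ lookup (Vec.head r) i
        go i (c ∷ r) = refl

      holds-left : (∀ i → nth ps (lookup (front k) i) ≡
                     just (shiftIn false (Vec.map (λ c → lookup c i) row))) →
                   Holds ps (front k) (shiftIn falses row)
      holds-left at = holds λ i → trans (at i) (cong just (sym
        (trans (map-shiftIn (λ c → lookup c i) falses row)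
               (cong (λ b → shiftIn b (Vec.map (λ c → lookup c i) row)) (lookup-replicate i false)))))

      holds-right : (∀ i → nth ps (lookup (front k) i) ≡
                      just (shiftOut (Vec.map (λ c → lookup c i) row) false)) →
                    Holds ps (front k) (shiftOut row falses)
      holds-right at = holds λ i → trans (at i) (cong just (sym
        (trans (map-shiftOut (λ c → lookup c i) row falses)
               (cong (shiftOut (Vec.map (λ c → lookup c i) row)) (lookup-replicate i false)))))

    run-row : ∀ k (F : Vec Bool (k + (k + (k + k))) → Vec Bool m) {ps row} →
      Holds ps (front k) row →
      ∃ λ qs → ps ⟹[ rowTemplate k F ] qs × Holds qs (front m) (Vec.map F (neighbourhoods row))
    run-row {m} k F {ps} {row} h₀
      with run-applyAll run-spread (front k) _ (plane h₀)
    ... | js₁ , eq₁ , e₁ , at₁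
      with run-applyAll run-fromLeft (Vec.map (k +_) (front k)) _
             (plane (holds-weaken js₁ eq₁ h₀))
    ... | js₂ , eq₂ , e₂ , at₂
      with run-applyAll run-fromRight (Vec.map (k +_) (Vec.map (k +_) (front k))) _
             (plane (holds-weaken js₂ eq₂ (holds-weaken js₁ eq₁ h₀)))
    ... | js₃ , eq₃ , e₃ , at₃
      with run-shannons (components F) (neighbours k) {neighbourhoods row}
             (holds-++ (front k) _ (holds-right {row = row} at₃)
               (holds-weaken js₃ eq₃
                 (holds-++ (front k) _ (holds-left {row = row} at₂)
                   (holds-weaken js₂ eq₂
                     (holds-++ (front k) _ (holds-head {row = row} at₁)
                       (holds-weaken js₁ eq₁ h₀))))))
    ... | js₄ , eq₄ , e₄ , at₄
      with run-applyAll run-duplicate (every (size (k + (k + (k + k)))) m) _ at₄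
    ... | js₅ , eq₅ , e₅ , at₅ =
      _ , (e₁ ▹ e₂ ▹ e₃ ▹ e₄ ▹ e₅) ,
      holds λ i → trans (at₅ i) (cong just
        (trans (map-cong (λ c → cong (λ g → g c) (lookup∘tabulate (λ i c → lookup (F c) i) i))
                 (neighbourhoods row))
               (map-∘ (λ c → lookup c i) F (neighbourhoods row))))

take-++ : ∀ {A : Set} (xs : Vec A m) (ys : Vec A n) → Vec.take m (xs Vec.++ ys) ≡ xs
take-++ []       ys = refl
take-++ (x ∷ xs) ys = cong (x ∷_) (take-++ xs ys)

drop-++ : ∀ {A : Set} (xs : Vec A m) (ys : Vec A n) → Vec.drop m (xs Vec.++ ys) ≡ ys
drop-++ []       ys = refl
drop-++ (x ∷ xs) ys = drop-++ xs ys

quarters : ∀ {A B : Set} k →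
  (Vec A k → Vec A k → Vec A k → Vec A k → B) → Vec A (k + (k + (k + k))) → B
quarters k f v = f (Vec.take k v) (Vec.take k v₁) (Vec.take k v₂) (Vec.drop k v₂)
  where
  v₁ = Vec.drop k v
  v₂ = Vec.drop k v₁

quarters-++ : ∀ {A B : Set} (f : Vec A k → Vec A k → Vec A k → Vec A k → B) a b c d →
  quarters k f (a Vec.++ (b Vec.++ (c Vec.++ d))) ≡ f a b c d
quarters-++ {k} {A} f a b c d
  rewrite take-++ a (b Vec.++ (c Vec.++ d)) | drop-++ a (b Vec.++ (c Vec.++ d))
        | take-++ b (c Vec.++ d) | drop-++ b (c Vec.++ d) | take-++ c d | drop-++ c d = refl

-- Fixed-length bit codes

record Code (A : Set) : Set where
  field
    bits    : ℕ
    enc     : A → Vec Bool bits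
    dec     : Vec Bool bits → Maybe A
    dec-enc : ∀ a → dec (enc a) ≡ just a

open Code

retract : ∀ {A B : Set} (f : A → B) (g : B → A) → (∀ a → g (f a) ≡ a) → Code B → Code A
retract f g gf c = record
  { bits    = bits c
  ; enc     = enc c ∘ f
  ; dec     = Maybe.map g ∘ dec c
  ; dec-enc = λ a → trans (cong (Maybe.map g) (dec-enc c (f a))) (cong just (gf a))
  }

code-Bool : Code Bool
code-Bool = record
  { bits = 1 ; enc = λ b → b ∷ [] ; dec = λ v → just (Vec.head v) ; dec-enc = λ b → refl }

pair : ∀ {A B : Set} → Maybe A → Maybe B → Maybe (A × B)
pair (just a) (just b) = just (a , b)
pair _        _        = nothing

infixr 4 _code-×_

_code-×_ : ∀ {A B : Set} → Code A → Code B → Code (A × B)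
c code-× d = record
  { bits    = bits c + bits d
  ; enc     = λ (a , b) → enc c a Vec.++ enc d b
  ; dec     = λ v → pair (dec c (Vec.take (bits c) v)) (dec d (Vec.drop (bits c) v))
  ; dec-enc = λ (a , b) → cong₂ pair
      (trans (cong (dec c) (take-++ (enc c a) (enc d b))) (dec-enc c a))
      (trans (cong (dec d) (drop-++ (enc c a) (enc d b))) (dec-enc d b))
  }

code-Vec : ∀ {A : Set} → Code A → ∀ n → Code (Vec A n)
code-Vec c zero    = record
  { bits = 0 ; enc = λ _ → [] ; dec = λ _ → just [] ; dec-enc = λ { [] → refl } }
code-Vec c (suc n) = retract (λ { (a ∷ as) → a , as }) (λ (a , as) → a ∷ as)
  (λ { (a ∷ as) → refl }) (c code-× code-Vec c n)

-- One-hot instead of binary: the length is a constant of the machine anyway, and decoding takes no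
-- arithmetic.
code-Fin : ∀ n → Code (Fin n)
code-Fin n = record { bits = n ; enc = oneHot ; dec = first ; dec-enc = first-oneHot }
  where
  oneHot : ∀ {n} → Fin n → Vec Bool n
  oneHot zero    = true ∷ Vec.replicate _ false
  oneHot (suc i) = false ∷ oneHot i
  first : ∀ {n} → Vec Bool n → Maybe (Fin n)
  first []          = nothing
  first (true  ∷ v) = just zero
  first (false ∷ v) = Maybe.map suc (first v)
  first-oneHot : ∀ {n} (i : Fin n) → first (oneHot i) ≡ just i
  first-oneHot zero    = refl
  first-oneHot (suc i) = cong (Maybe.map suc) (first-oneHot i)

code-Symbol : ∀ g → Code (Symbol g)
code-Symbol g = retract there back back∘there (code-Fin (3 + g))
  where
  there : Symbol g → Fin (3 + g)
  there blank       = zero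
  there (bit false) = suc zero
  there (bit true)  = suc (suc zero)
  there (aux i)     = suc (suc (suc i))
  back : Fin (3 + g) → Symbol g
  back zero                = blank
  back (suc zero)          = bit false
  back (suc (suc zero))    = bit true
  back (suc (suc (suc i))) = aux i
  back∘there : ∀ s → back (there s) ≡ s
  back∘there blank       = refl
  back∘there (bit false) = refl
  back∘there (bit true)  = refl
  back∘there (aux i)     = refl

-- The code of a cell is marked by a leading 1, which distinguishes it from
-- the all-0 filling beyond the ends of a row.
module Marked {A : Set} (code : Code A) where

  width : ℕ
  width = suc (bits code)

  mark : A → Vec Bool width
  mark a = true ∷ enc code a

  unmark : Vec Bool width → Maybe A
  unmark (false ∷ v) = nothing
  unmark (true  ∷ v) = dec code v

  mark? : Maybe A → Vec Bool width
  mark? nothing  = Vec.replicate width false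
  mark? (just a) = mark a

  unmark-mark? : ∀ a → unmark (mark? a) ≡ a
  unmark-mark? nothing  = refl
  unmark-mark? (just a) = dec-enc code a

  -- The four cells are the right neighbour, the left neighbour, the
  -- leftmost cell of the row and the cell itself.
  onCells : (Maybe A → Maybe A → A → A → A) → (r l h c : Vec Bool width) → Vec Bool width
  onCells G r l h c = mark? (both (unmark h) (unmark c))
    where
    both : Maybe A → Maybe A → Maybe A
    both (just h) (just c) = just (G (unmark r) (unmark l) h c)
    both _        _        = nothing

  onCells-mark : ∀ G r l h c →
    onCells G (mark? r) (mark? l) (mark h) (mark c) ≡ mark (G r l h c)
  onCells-mark G r l h c rewrite dec-enc code h | dec-enc code c =
    cong₂ (λ r l → mark (G r l h c)) (unmark-mark? r) (unmark-mark? l)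

-- Rows as functions of the position

row : ∀ {A : Set} → (ℕ → A) → ∀ n → Vec A n
row f zero    = []
row f (suc n) = f 0 ∷ row (f ∘ suc) n

row-cong : ∀ {A : Set} {f g : ℕ → A} n → (∀ j → j < n → f j ≡ g j) → row f n ≡ row g n
row-cong zero    eq = refl
row-cong (suc n) eq = cong₂ _∷_ (eq 0 (s≤s z≤n)) (row-cong n (λ j h → eq (suc j) (s≤s h)))

map-row : ∀ {A B : Set} (F : A → B) f n → Vec.map F (row f n) ≡ row (F ∘ f) n
map-row F f zero    = refl
map-row F f (suc n) = cong (F (f 0) ∷_) (map-row F (f ∘ suc) n)

zipWith-row : ∀ {A B C : Set} (F : A → B → C) f g n →
              Vec.zipWith F (row f n) (row g n) ≡ row (λ j → F (f j) (g j)) n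
zipWith-row F f g zero    = refl
zipWith-row F f g (suc n) = cong (_ ∷_) (zipWith-row F (f ∘ suc) (g ∘ suc) n)

replicate-row : ∀ {A : Set} (a : A) n → Vec.replicate n a ≡ row (λ _ → a) n
replicate-row a zero    = refl
replicate-row a (suc n) = cong (a ∷_) (replicate-row a n)

delay : ∀ {A : Set} → A → (ℕ → A) → ℕ → A
delay z f zero    = z
delay z f (suc j) = f j

shiftIn-row : ∀ {A : Set} z (f : ℕ → A) n → shiftIn z (row f n) ≡ row (delay z f) n
shiftIn-row z f zero    = refl
shiftIn-row z f (suc n) =
  cong (z ∷_) (trans (shiftIn-row (f 0) (f ∘ suc) n)
    (row-cong n λ { zero _ → refl ; (suc j) _ → refl }))

cut : ∀ {A : Set} → ℕ → A → (ℕ → A) → ℕ → A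
cut zero    z f j       = z
cut (suc n) z f zero    = f 0
cut (suc n) z f (suc j) = cut n z (f ∘ suc) j

cut-< : ∀ {A : Set} n z (f : ℕ → A) j → j < n → cut n z f j ≡ f j
cut-< (suc n) z f zero    h       = refl
cut-< (suc n) z f (suc j) (s≤s h) = cut-< n z (f ∘ suc) j h

cut-end : ∀ {A : Set} n z (f : ℕ → A) → cut n z f n ≡ z
cut-end zero    z f = refl
cut-end (suc n) z f = cut-end n z (f ∘ suc)

shiftOut-row : ∀ {A : Set} z (f : ℕ → A) n → shiftOut (row f n) z ≡ row (cut n z f ∘ suc) n
shiftOut-row z f zero    = refl
shiftOut-row z f (suc n) = go n (f ∘ suc)
  where
  go : ∀ n f → row f n ∷ʳ z ≡ row (cut n z f) (suc n)
  go zero    f = refl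
  go (suc n) f = cong (f 0 ∷_) (go n (f ∘ suc))

-- Simulating one step of a Turing machine by a local rule

symbolAt : ∀ {g} → List (Symbol g) → ℕ → Symbol g
symbolAt []       j       = blank
symbolAt (s ∷ ss) zero    = s
symbolAt (s ∷ ss) (suc j) = symbolAt ss j

symbolAt-beyond : ∀ {g} (ss : List (Symbol g)) {j} → length ss ≤ j → symbolAt ss j ≡ blank
symbolAt-beyond []       h       = refl
symbolAt-beyond (s ∷ ss) (s≤s h) = symbolAt-beyond ss h

record TapeCell (g : ℕ) : Set where
  constructor cell
  field
    behind here ahead : Symbol g

open TapeCell

-- Position j of a tape holds the cells at distance j + 1 from the head on
-- both sides, next to a copy of the scanned cell.
tapeCell : ∀ {g} → Tape g → ℕ → TapeCell g
tapeCell (tape ls s rs) j = cell (symbolAt ls j) s (symbolAt rs j)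

behind? ahead? : ∀ {g} → Symbol g → Maybe (TapeCell g) → Symbol g
behind? = maybe′ behind
ahead?  = maybe′ ahead

-- On a left move the half behind the head comes one position closer, from the right neighbour, and
-- the half ahead moves one further, from the left neighbour; cell 0 supplies the symbol coming
-- under the head. Only position 0 lacks a left neighbour, and there the default is the symbol just
-- written. The default `blank` serves the right end of the row.
moveCell : ∀ {g} → Symbol g × Move →
           Maybe (TapeCell g) → Maybe (TapeCell g) → TapeCell g → TapeCell g → TapeCell g
moveCell (s , left)  r l h c = cell (behind? blank r) (behind h) (ahead? s l)
moveCell (s , stay)  r l h c = cell (behind c) s (ahead c)
moveCell (s , right) r l h c = cell (behind? s l) (ahead h) (ahead? blank r)

Fits : ∀ {g} → ℕ → Tape g → Set
Fits n (tape ls s rs) = length ls ≤ n × length rs ≤ n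

fits-mono : ∀ {g m n} (t : Tape g) → m ≤ n → Fits m t → Fits n t
fits-mono (tape ls s rs) h (p , q) = ≤-trans p h , ≤-trans q h

fits-writeMove : ∀ {g n} a (t : Tape g) → Fits n t → Fits (suc n) (writeMove a t)
fits-writeMove (s , left)  (tape []       _ rs)       (p , q) = z≤n , s≤s q
fits-writeMove (s , left)  (tape (l ∷ ls) _ rs)       (p , q) = ≤-trans (n≤1+n _) (m≤n⇒m≤1+n p) , s≤s q
fits-writeMove (s , stay)  (tape ls       _ rs)       (p , q) = m≤n⇒m≤1+n p , m≤n⇒m≤1+n q
fits-writeMove (s , right) (tape ls       _ [])       (p , q) = s≤s p , z≤n
fits-writeMove (s , right) (tape ls       _ (r ∷ rs)) (p , q) = s≤s p , ≤-trans (n≤1+n _) (m≤n⇒m≤1+n q)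

-- The two equations ask of the right neighbour only what it contributes. They hold for the cell at
-- j + 1, and also for a missing one if the tape is blank there.
moveCell-writeMove : ∀ {g} a (t : Tape g) j r →
  behind? blank r ≡ symbolAt (Tape.before t) (suc j) →
  ahead? blank r ≡ symbolAt (Tape.after t) (suc j) →
  moveCell a r (delay nothing (just ∘ tapeCell t) j) (tapeCell t 0) (tapeCell t j)
    ≡ tapeCell (writeMove a t) j
moveCell-writeMove (s , left)  (tape []       c rs) zero    r p q = cong (λ b → cell b blank s) p
moveCell-writeMove (s , left)  (tape []       c rs) (suc j) r p q =
  cong (λ b → cell b blank (symbolAt rs j)) p
moveCell-writeMove (s , left)  (tape (l ∷ ls) c rs) zero    r p q = cong (λ b → cell b l s) p
moveCell-writeMove (s , left)  (tape (l ∷ ls) c rs) (suc j) r p q =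
  cong (λ b → cell b l (symbolAt rs j)) p
moveCell-writeMove (s , stay)  t                    j       r p q = refl
moveCell-writeMove (s , right) (tape ls c [])       zero    r p q = cong (cell s blank) q
moveCell-writeMove (s , right) (tape ls c [])       (suc j) r p q = cong (cell (symbolAt ls j) blank) q
moveCell-writeMove (s , right) (tape ls c (x ∷ rs)) zero    r p q = cong (cell s x) q
moveCell-writeMove (s , right) (tape ls c (x ∷ rs)) (suc j) r p q = cong (cell (symbolAt ls j) x) q

code-TapeCell : ∀ g → Code (TapeCell g)
code-TapeCell g = retract (λ (cell b s a) → b , s , a) (λ (b , s , a) → cell b s a) (λ _ → refl)
  (code-Symbol g code-× code-Symbol g code-× code-Symbol g)

module Simulation {i : ℕ} (M : Machine i) where
  open Machine M

  record Cell : Set where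
    constructor cell
    field
      -- The bit x₁, which is needed at the end.
      flag  : Bool
      state : State
      cells : Vec (TapeCell auxiliary) tapes

  open Cell

  code-State : Code State
  code-State = retract (Inverse.to f) (Inverse.from f) (Inverse.strictlyInverseʳ f)
    (code-Fin (proj₁ finite))
    where f = proj₂ finite

  abstract
    code-Cell : Code Cell
    code-Cell = retract (λ (cell b q cs) → b , q , cs) (λ (b , q , cs) → cell b q cs) (λ _ → refl)
      (code-Bool code-× code-State code-× code-Vec (code-TapeCell auxiliary) tapes)

  configCell : Bool → Config → ℕ → Cell
  configCell b (q , ts) j = cell b q (Vec.map (λ t → tapeCell t j) ts)

  -- State and scanned symbols are read off cell 0, which makes all cells take the same transition.
  -- Once the machine has halted the cells stay as they are, in agreement with `run`.
  nextCell : Maybe Cell → Maybe Cell → Cell → Cell → Cell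
  nextCell r l h c with δ (state h) (Vec.map here (cells h))
  ... | nothing       = c
  ... | just (q , as) = cell (flag h) q (Vec.tabulate λ i →
    moveCell (lookup as i) (Maybe.map (λ c → lookup (cells c) i) r)
      (Maybe.map (λ c → lookup (cells c) i) l) (lookup (cells h) i) (lookup (cells c) i))

  next′ : Config → Config
  next′ c = maybe′ (λ c′ → c′) c (step c)

  FitsAll : ℕ → Config → Set
  FitsAll n (q , ts) = ∀ i → Fits n (lookup ts i)

  heads-cells : ∀ {l} (ts : Vec (Tape auxiliary) l) →
    Vec.map here (Vec.map (λ t → tapeCell t 0) ts) ≡ Vec.map Tape.scanned ts
  heads-cells []       = refl
  heads-cells (t ∷ ts) = cong (_ ∷_) (heads-cells ts)

  nextCell-correct : ∀ b c j r →
    (∀ i → let t = lookup (proj₂ c) i ; r′ = Maybe.map (λ c → lookup (cells c) i) r in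
      behind? blank r′ ≡ symbolAt (Tape.before t) (suc j) ×
      ahead? blank r′ ≡ symbolAt (Tape.after t) (suc j)) →
    nextCell r (delay nothing (just ∘ configCell b c) j) (configCell b c 0) (configCell b c j)
      ≡ configCell b (next′ c) j
  nextCell-correct b (q , ts) j r h rewrite heads-cells ts with δ q (Vec.map Tape.scanned ts)
  ... | nothing        = refl
  ... | just (q′ , as) = cong (cell b q′) (trans (tabulate-cong eq) (tabulate∘lookup _))
    where
    left-cell : ∀ j i →
      Maybe.map (λ c → lookup (cells c) i) (delay nothing (just ∘ configCell b (q , ts)) j)
        ≡ delay nothing (just ∘ tapeCell (lookup ts i)) j
    left-cell zero    i = refl
    left-cell (suc j) i = cong just (lookup-map i _ ts)
    eq : ∀ i → moveCell (lookup as i) (Maybe.map (λ c → lookup (cells c) i) r)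
           (Maybe.map (λ c → lookup (cells c) i) (delay nothing (just ∘ configCell b (q , ts)) j))
           (lookup (Vec.map (λ t → tapeCell t 0) ts) i) (lookup (Vec.map (λ t → tapeCell t j) ts) i)
         ≡ lookup (Vec.map (λ t → tapeCell t j) (Vec.zipWith writeMove as ts)) i
    eq i rewrite left-cell j i
               | lookup-map i (λ t → tapeCell t 0) ts | lookup-map i (λ t → tapeCell t j) ts
               | lookup-map i (λ t → tapeCell t j) (Vec.zipWith writeMove as ts)
               | lookup-zipWith writeMove i as ts =
      moveCell-writeMove (lookup as i) (lookup ts i) j _ (proj₁ (h i)) (proj₂ (h i))

  fits-next : ∀ {n} c → FitsAll n c → FitsAll (suc n) (next′ c)
  fits-next (q , ts) h i with δ q (Vec.map Tape.scanned ts)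
  ... | nothing        = fits-mono (lookup ts i) (n≤1+n _) (h i)
  ... | just (q′ , as) = subst (Fits _) (sym (lookup-zipWith writeMove i as ts))
                           (fits-writeMove (lookup as i) (lookup ts i) (h i))

  -- `run` splits off the first step, whereas the induction along the simulation appends a last one.
  run-suc : ∀ t c → run (suc t) c ≡ next′ (run t c)
  run-suc zero    c with step c
  ... | nothing = refl
  ... | just _  = refl
  run-suc (suc t) c with step c in eq
  ... | nothing = sym (cong (maybe′ (λ c′ → c′) c) eq)
  ... | just c′ = run-suc t c′

  open Marked code-Cell public

  configRow : Bool → Config → ∀ n → Vec (Vec Bool width) n
  configRow b c n = row (mark ∘ configCell b c) n

-- The initial row and acceptance

valid value : Maybe Bool → Bool
valid nothing  = false
valid (just b) = true
value nothing  = false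
value (just b) = b

nth-beyond : ∀ {A : Set} (xs : List A) {j} → length xs ≤ j → nth xs j ≡ nothing
nth-beyond []       h       = refl
nth-beyond (x ∷ xs) (s≤s h) = nth-beyond xs h

inputCell : List Bool → List Bool → List Bool → ℕ → Vec Bool 6
inputCell w x y j = valid (nth w j) ∷ value (nth w j) ∷ valid (nth x j) ∷ value (nth x j) ∷
                    valid (nth y j) ∷ value (nth y j) ∷ []

module Start (M : Machine 3) where
  open Machine M
  open Simulation M

  symbol : Bool → Bool → Symbol auxiliary
  symbol false b = blank
  symbol true  b = bit b

  symbols : Vec Bool 6 → Vec (Symbol auxiliary) 3
  symbols (a ∷ b ∷ c ∷ d ∷ e ∷ f ∷ []) = symbol a b ∷ symbol c d ∷ symbol e f ∷ []

  flagOf : Vec Bool 6 → Bool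
  flagOf (_ ∷ _ ∷ _ ∷ b ∷ _) = b

  -- With the heads on the first bits, position j has bit 0 as scanned symbol and bit j + 1 ahead.
  -- So the initial cell depends on cell 0 and the right neighbour in the row of inputs, and
  -- `rowTemplate` produces it as well.
  startCell : Vec Bool 6 → Vec Bool 6 → Cell
  startCell r h = cell (flagOf h) start
    (cell blank blank blank ∷
      (Vec.zipWith (cell blank) (symbols h) (symbols r) Vec.++
       Vec.replicate work (cell blank blank blank)))

  load-cell : ∀ (u : List Bool) j →
    tapeCell (load u) j ≡ cell blank (symbol (valid (nth u 0)) (value (nth u 0)))
                                     (symbol (valid (nth u (suc j))) (value (nth u (suc j))))
  load-cell []      j = refl
  load-cell (b ∷ u) j = cong (cell blank (bit b)) (go u j)
    where
    go : ∀ u j → symbolAt (map bit u) j ≡ symbol (valid (nth u j)) (value (nth u j))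
    go []      j       = refl
    go (b ∷ u) zero    = refl
    go (b ∷ u) (suc j) = go u j

  startCell-correct : ∀ w x y j →
    startCell (inputCell w x y (suc j)) (inputCell w x y 0)
      ≡ configCell (value (nth x 0)) (initial (w ∷ x ∷ y ∷ [])) j
  startCell-correct w x y j =
   cong (λ cs → cell (value (nth x 0)) start (cell blank blank blank ∷ cs)) (sym
    (trans (map-++ (λ t → tapeCell t j) (Vec.map load (w ∷ x ∷ y ∷ [])) (Vec.replicate work blankTape))
      (cong₂ Vec._++_ inputs (map-replicate (λ t → tapeCell t j) blankTape work))))
    where
    inputs : tapeCell (load w) j ∷ tapeCell (load x) j ∷ tapeCell (load y) j ∷ []
             ≡ Vec.zipWith (cell blank) (symbols (inputCell w x y 0)) (symbols (inputCell w x y (suc j)))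
    inputs = cong₂ _∷_ (load-cell w j) (cong₂ _∷_ (load-cell x j) (cong₂ _∷_ (load-cell y j) refl))

  isOne : Symbol auxiliary → Bool
  isOne (bit b) = b
  isOne _       = false

  unload-singleton : ∀ (t : Tape auxiliary) {b} → unload t ≡ b ∷ [] → isOne (Tape.scanned t) ≡ b
  unload-singleton (tape ls (bit b) rs) eq = ∷-injectiveˡ eq
  unload-singleton (tape ls blank rs)   ()
  unload-singleton (tape ls (aux i) rs) ()

  accept : Vec Bool width → Bool
  accept v =
    maybe′ (λ c → isOne (TapeCell.here (Vec.head (Cell.cells c))) ∧ Cell.flag c) false (unmark v)

  accept-config : ∀ b c →
    accept (mark (configCell b c 0)) ≡ isOne (Tape.scanned (Vec.head (proj₂ c))) ∧ b
  accept-config b (q , t ∷ ts) rewrite unmark-mark? (just (configCell b (q , t ∷ ts) 0)) = refl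

  scanned-output : ∀ (c : Config) {b} → output c ≡ b ∷ [] →
                   isOne (Tape.scanned (Vec.head (proj₂ c))) ≡ b
  scanned-output (q , t ∷ ts) = unload-singleton t

  fits-load : ∀ {n} (u : List Bool) → length u ≤ n → Fits {auxiliary} n (load u)
  fits-load []      h = z≤n , z≤n
  fits-load (b ∷ u) h = z≤n , ≤-trans (≤-reflexive (length-map bit u)) (≤-trans (n≤1+n _) h)

  fits-initial : ∀ {n} xs → (∀ i → length (lookup xs i) ≤ n) → FitsAll n (initial xs)
  fits-initial {n} xs h zero    = z≤n , z≤n
  fits-initial {n} xs h (suc i) = go xs h i
    where
    go : ∀ {l} (xs : Vec (List Bool) l) → (∀ i → length (lookup xs i) ≤ n) → ∀ i →
         Fits {auxiliary} n (lookup (Vec.map load xs Vec.++ Vec.replicate work blankTape) i)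
    go []       h i       = subst (Fits n) (sym (lookup-replicate i blankTape)) (z≤n , z≤n)
    go (u ∷ xs) h zero    = fits-load u (h zero)
    go (u ∷ xs) h (suc i) = go xs (h ∘ suc) i

emit-cst : ∀ b k {ws} → ws ⟶[ pow k (cst b ∷ []) ] List.replicate k b ++ ws
emit-cst b zero    = []
emit-cst b (suc k) = emit-cst b k ◅◅ (cst ∷ [])

emit-copy : ∀ {i ws} (v : Vec Bool k) → At ws (suc i) v →
            ws ⟶[ pow k (copyOf (k + i) ∷ []) ] toList v ++ ws
emit-copy {i = i} v at = emit (copyOf i) v (lanes-copy v at)

toList-row : ∀ (h : Maybe Bool → Bool) l k {n} → n ≡ length l + k →
  toList (row (h ∘ nth l) n) ≡ map (h ∘ just) l ++ List.replicate k (h nothing)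
toList-row h []      zero    refl = refl
toList-row h []      (suc k) refl = cong (h nothing ∷_) (toList-row h [] k refl)
toList-row h (b ∷ l) k       refl = cong (h (just b) ∷_) (toList-row h l k refl)

description : Count → Template → Exp
description c t = unaryᴱ c · templateᴱ t · bit false · unaryᴱ (lit 0)

described : ∀ c t w (v : Vec Bool (val c (length w))) {us b} →
  toList v ⟶[ gates t w ] us → nth us 0 ≡ just b →
  ∃ λ (C : Circuit (val c (length w))) → str (description c t) w ≡ encode C ×
    (∀ (v′ : Vec Bool (val c (length w))) {us′ b′} →
      toList v′ ⟶[ gates t w ] us′ → nth us′ 0 ≡ just b′ → eval C v′ ≡ b′)
described c t w v e at =
  let C , body , correct = typedCircuit v (gates t w) e at in
  C ,
  cong₂ _++_ (str-unaryᴱ c w)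
    (trans (cong (_++ false ∷ false ∷ []) (str-templateᴱ t w)) (sym body)) ,
  correct

-- Rows of 2 + (N + (m + T)) cells, where N = |w|, m = p(N) and T bounds the
-- running time, are wide enough for all tapes.
module Reduction (M : Machine 3) (p t : Polynomial) where
  open Machine M using (initial; Config; auxiliary)
  open Simulation M
  open Start M

  m# T# W₂ : Count
  m# = horner p len
  -- The argument has the shape of `Vec.sum` over the lengths |w|, p(|w|), p(|w|), whose last
  -- summand is 0.
  T# = horner t (len ⊞ (m# ⊞ (m# ⊞ lit 0)))
  W₂ = len ⊞ (m# ⊞ T#)

  open Rows W₂

  -- Later wires get smaller numbers, so the end of a row, its padding, is emitted before its
  -- content.
  padded : Count → Template → Template
  padded c content = repeated c (cst false) ▸ content

  -- padX is 1 ⊞ offset, and the references of a repeated gate are counted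
  -- from its last copy on, whence m# ⊞ offset.
  offset padX padW : Count
  offset = lit 1 ⊞ (len ⊞ T#)
  padX   = lit 1 ⊞ offset
  padW   = lit 2 ⊞ (m# ⊞ T#)

  copyX copyY copyW : Template
  -- Above x lie the padding and the two finished planes for y; above y lie the padding and x.
  copyX = repeated m# (copyOf (m# ⊞ (offset ⊞ (W ⊞ (W ⊞ lit 0)))))
  copyY = repeated m# (copyOf (m# ⊞ (offset ⊞ m#)))
  copyW = read (one (cst false)) (one (cst true))

  trues : Count → Template
  trues c = repeated c (cst true)

  inputTemplate startTemplate stepTemplate : Template
  inputTemplate =
    padded padX copyY ▸ padded padX (trues m#) ▸
    padded padX copyX ▸ padded padX (trues m#) ▸
    padded padW copyW ▸ padded padW (trues len)
  startTemplate = rowTemplate 6 (quarters 6 λ r l h c → mark (startCell r h))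
  stepTemplate  = rowTemplate width (quarters width (onCells nextCell))

  -- Unfolding the Shannon expansions, which have at least 24 variables, is
  -- infeasible.
  opaque
    template : Template
    template = inputTemplate ▸ startTemplate ▸ times T# stepTemplate ▸ shannon accept (front width)

  module _ (w : List Bool) where

    open Correct w

    mₙ Tₙ : ℕ
    mₙ = val m# (length w)
    Tₙ = val T# (length w)

    neighbourhoods-row : ∀ {A : Set} (f : Vec Bool k → Vec Bool k → Vec Bool k → Vec Bool k → A) e →
      Vec.map (quarters k f) (neighbourhoods (row e ℓ))
        ≡ row (λ j → f (cut ℓ falses e (suc j)) (delay falses e j) (e 0) (e j)) ℓ
    neighbourhoods-row {k} f e =
      trans (cong (Vec.map (quarters k f)) rows)
        (trans (map-row (quarters k f) around ℓ)
          (row-cong ℓ λ j _ → quarters-++ f (cut ℓ falses e (suc j)) (delay falses e j) (e 0) (e j)))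
      where
      self : ℕ → Vec Bool (k + k)
      left-self : ℕ → Vec Bool (k + (k + k))
      around : ℕ → Vec Bool (k + (k + (k + k)))
      self j      = e 0 Vec.++ e j
      left-self j = delay falses e j Vec.++ self j
      around j    = cut ℓ falses e (suc j) Vec.++ left-self j
      rows : neighbourhoods (row e ℓ) ≡ row around ℓ
      rows =
        trans (cong₂ (Vec.zipWith Vec._++_) (shiftOut-row falses e ℓ)
          (trans (cong₂ (Vec.zipWith Vec._++_) (shiftIn-row falses e ℓ)
            (trans (cong (λ r → Vec.zipWith Vec._++_ r (row e ℓ)) (replicate-row (e 0) ℓ))
              (zipWith-row Vec._++_ (λ _ → e 0) e ℓ)))
            (zipWith-row Vec._++_ (delay falses e) self ℓ)))
          (zipWith-row Vec._++_ (λ j → cut ℓ falses e (suc j)) left-self ℓ)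

    run-step : ∀ b c {ps} → FitsAll ℓ c → Holds ps (front width) (configRow b c ℓ) →
      ∃ λ qs → ps ⟹[ stepTemplate ] qs × Holds qs (front width) (configRow b (next′ c) ℓ)
    run-step b c fits h =
      let qs , e , h′ = run-row width (quarters width (onCells nextCell)) h in
      qs , e , subst (Holds qs (front width))
        (trans (neighbourhoods-row (onCells nextCell) E) (row-cong ℓ local)) h′
      where
      E : ℕ → Vec Bool width
      E = mark ∘ configCell b c
      delay-mark : ∀ j → delay falses E j ≡ mark? (delay nothing (just ∘ configCell b c) j)
      delay-mark zero    = refl
      delay-mark (suc j) = refl
      local : ∀ j → j < ℓ → onCells nextCell (cut ℓ falses E (suc j)) (delay falses E j) (E 0) (E j)
                            ≡ mark (configCell b (next′ c) j)
      local j j<n with m≤n⇒m<n∨m≡n j<n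
      ... | inj₁ sj<n = trans
        (cong₂ (λ u v → onCells nextCell u v (E 0) (E j)) (cut-< ℓ falses E (suc j) sj<n) (delay-mark j))
        (trans
          (onCells-mark nextCell (just (configCell b c (suc j))) _ (configCell b c 0) (configCell b c j))
          (cong mark (nextCell-correct b c j _ λ i →
            cong TapeCell.behind (lookup-map i (λ t → tapeCell t (suc j)) (proj₂ c)) ,
            cong TapeCell.ahead (lookup-map i (λ t → tapeCell t (suc j)) (proj₂ c)))))
      -- The last cell sees the filling as its right neighbour. Position `suc j` is then `ℓ`, beyond
      -- everything on a tape that fits, so that blanks are the right contribution.
      ... | inj₂ sj≡n = trans
        (cong₂ (λ u v → onCells nextCell u v (E 0) (E j))
          (trans (cong (cut ℓ falses E) sj≡n) (cut-end ℓ falses E)) (delay-mark j))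
        (trans (onCells-mark nextCell nothing _ (configCell b c 0) (configCell b c j))
          (cong mark (nextCell-correct b c j nothing λ i →
            sym (symbolAt-beyond (Tape.before (lookup (proj₂ c) i))
                  (≤-trans (proj₁ (fits i)) (≤-reflexive (sym sj≡n)))) ,
            sym (symbolAt-beyond (Tape.after (lookup (proj₂ c) i))
                  (≤-trans (proj₂ (fits i)) (≤-reflexive (sym sj≡n)))))))

    -- The bound on the round number j is what lets the body conclude that the tapes still fit into
    -- the row.
    run-times : ∀ c t (P : ℕ → List Plane → Set) →
      (∀ j {ps} → j < val c (length w) → P j ps → ∃ λ qs → ps ⟹[ t ] qs × P (suc j) qs) →
      ∀ {ps} → P 0 ps → ∃ λ qs → ps ⟹[ times c t ] qs × P (val c (length w)) qs
    run-times c t P body {ps} h =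
      let qs , e , h′ = go (val c (length w)) ≤-refl in qs , ⟨ e ⟩ , h′
      where
      go : ∀ k → k ≤ val c (length w) →
           ∃ λ qs → (∀ rest → wires ps rest ⟶[ pow k (gates t w) ] wires qs rest) × P k qs
      go zero    _ = ps , (λ rest → []) , h
      go (suc k) k< with go k (<⇒≤ k<)
      ... | qs , e , h′ with body k k< h′
      ... | rs , e′ , h″ = rs , (λ rest → e rest ◅◅ steps e′ rest) , h″

    emit-read : ∀ {ws} → ws ⟶[ gates copyW w ] w ++ ws
    emit-read {ws} = go w
      where
      go : ∀ v → ws ⟶[ revConcat (λ b → if b then cst true ∷ [] else cst false ∷ []) v ] v ++ ws
      go []          = []
      go (false ∷ v) = go v ◅◅ (cst ∷ [])
      go (true ∷ v)  = go v ◅◅ (cst ∷ [])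

    emit-padded : ∀ h l c t {ws} → h nothing ≡ false → ℓ ≡ length l + val c (length w) →
      (List.replicate (val c (length w)) false ++ ws
        ⟶[ gates t w ] map (h ∘ just) l ++ List.replicate (val c (length w)) false ++ ws) →
      ws ⟶[ gates (padded c t) w ] toList (row (h ∘ nth l) ℓ) ++ ws
    emit-padded h l c t {ws} h≡ n≡ e =
      subst (ws ⟶[ gates (padded c t) w ]_)
        (sym (trans
          (cong (_++ ws) (trans (toList-row h l (val c (length w)) n≡)
            (cong (λ b → map (h ∘ just) l ++ List.replicate (val c (length w)) b) h≡)))
          (++-assoc (map (h ∘ just) l) _ ws)))
        (emit-cst false (val c (length w)) ◅◅ e)

    emit-valid : ∀ l c t → ℓ ≡ length l + val c (length w) →
      gates t w ≡ pow (length l) (cst true ∷ []) → ∀ {ws} →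
      ws ⟶[ gates (padded c t) w ] toList (row (valid ∘ nth l) ℓ) ++ ws
    emit-valid l c t n≡ t≡ {ws} = emit-padded valid l c t refl n≡
      (subst₂ (λ gs us → _ ⟶[ gs ] us ++ _) (sym t≡) (ones l) (emit-cst true (length l)))
      where
      ones : ∀ (l : List Bool) → List.replicate (length l) true ≡ map (valid ∘ just) l
      ones []      = refl
      ones (b ∷ l) = cong (true ∷_) (ones l)

    emit-value : ∀ l c t {ws} → ℓ ≡ length l + val c (length w) →
      (List.replicate (val c (length w)) false ++ ws
        ⟶[ gates t w ] l ++ List.replicate (val c (length w)) false ++ ws) →
      ws ⟶[ gates (padded c t) w ] toList (row (value ∘ nth l) ℓ) ++ ws
    emit-value l c t n≡ e = emit-padded value l c t refl n≡
      (subst (λ us → _ ⟶[ gates t w ] us ++ _) (sym (map-id l)) e)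

    at-replicate : ∀ j {b ws i} (v : Vec Bool k) → At ws i v → At (List.replicate j b ++ ws) (j + i) v
    at-replicate zero    v at = at
    at-replicate (suc j) v at = at-∷ _ v (at-replicate j v at)

    at-append : ∀ (u : Vec Bool k) (v : Vec Bool m) → At (toList (u Vec.++ v)) k v
    at-append []      v = subst (λ ws → At ws 0 v) (++-identityʳ (toList v)) (at-front v [])
    at-append (b ∷ u) v = at-∷ b v (at-append u v)

    at-prefix : ∀ (u : Vec Bool k) (v : Vec Bool m) → At (toList (u Vec.++ v)) 0 u
    at-prefix u v = subst (λ ws → At ws 0 u) (sym (toList-++ u v)) (at-front u (toList v))

    inputPlane : List Bool → List Bool → List Bool → Fin 6 → Plane
    inputPlane x y z i = row (λ j → lookup (inputCell x y z j) i) ℓ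

    run-input : ∀ (x y : Vec Bool mₙ) → let ws = toList (x Vec.++ y) in
      ∃ λ ps → ws ⟶[ gates inputTemplate w ] wires ps ws ×
        Holds ps (front 6) (row (inputCell w (toList x) (toList y)) ℓ)
    run-input x y =
      inputPlane w X Y 0F ∷ inputPlane w X Y 1F ∷ inputPlane w X Y 2F ∷
      inputPlane w X Y 3F ∷ inputPlane w X Y 4F ∷
      inputPlane w X Y 5F ∷ [] ,
      emit-value Y padX copyY n≡Y (emit-copy y (at-replicate (val padX N) y (at-append x y))) ◅◅
      emit-valid Y padX (trues m#) n≡Y (cong (λ l → pow l (cst true ∷ [])) (sym (length-toList y))) ◅◅
      emit-value X padX copyX n≡X (emit-copy x (at-replicate (val padX N) x
        (at-++ (inputPlane w X Y 4F) x
          (at-++ (inputPlane w X Y 5F) x (at-prefix x y))))) ◅◅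
      emit-valid X padX (trues m#) n≡X (cong (λ l → pow l (cst true ∷ [])) (sym (length-toList x))) ◅◅
      emit-value w padW copyW n≡w emit-read ◅◅
      emit-valid w padW (trues len) n≡w refl ,
      holds λ { 0F → column 0F
              ; 1F → column 1F
              ; 2F → column 2F
              ; 3F → column 3F
              ; 4F → column 4F
              ; 5F → column 5F }
      where
      N = length w
      X = toList x
      Y = toList y
      arith-w : ∀ N m T → 2 + (N + (m + T)) ≡ N + (2 + (m + T))
      arith-w = solve-∀
      arith-x : ∀ N m T → 2 + (N + (m + T)) ≡ m + (2 + (N + T))
      arith-x = solve-∀
      n≡w : ℓ ≡ length w + val padW N
      n≡w = arith-w N mₙ Tₙ
      n≡X : ℓ ≡ length X + val padX N
      n≡X = trans (arith-x N mₙ Tₙ) (cong (_+ val padX N) (sym (length-toList x)))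
      n≡Y : ℓ ≡ length Y + val padX N
      n≡Y = trans (arith-x N mₙ Tₙ) (cong (_+ val padX N) (sym (length-toList y)))
      column : ∀ i →
        just (inputPlane w X Y i) ≡ just (Vec.map (λ c → lookup c i) (row (inputCell w X Y) ℓ))
      column i = cong just (sym (map-row (λ c → lookup c i) (inputCell w X Y) ℓ))

    module _ (x y : Vec Bool mₙ) where

      X Y : List Bool
      X = toList x
      Y = toList y

      input : ℕ → Vec Bool 6
      input = inputCell w X Y

      flag₀ : Bool
      flag₀ = value (nth X 0)

      config : ℕ → Config
      config j = Machine.run M j (initial (w ∷ X ∷ Y ∷ []))

      input-beyond : ∀ {j} → ℓ ≡ j → falses ≡ input j
      input-beyond refl = cells (nth-beyond w (≤-trans (m≤m+n _ (mₙ + Tₙ)) (m≤n+m _ 2)))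
        (nth-beyond X (≤-trans (≤-reflexive (length-toList x)) m≤n))
        (nth-beyond Y (≤-trans (≤-reflexive (length-toList y)) m≤n))
        where
        cells : ∀ {a b c : Maybe Bool} → a ≡ nothing → b ≡ nothing → c ≡ nothing →
                falses ≡ valid a ∷ value a ∷ valid b ∷ value b ∷ valid c ∷ value c ∷ []
        cells refl refl refl = refl
        m≤n : mₙ ≤ ℓ
        m≤n = ≤-trans (m≤m+n _ Tₙ) (≤-trans (m≤n+m _ (length w)) (m≤n+m _ 2))

      run-start : ∀ {ps} → Holds ps (front 6) (row input ℓ) →
        ∃ λ qs → ps ⟹[ startTemplate ] qs × Holds qs (front width) (configRow flag₀ (config 0) ℓ)
      run-start h =
        let qs , e , h′ = run-row 6 (quarters 6 λ r l h c → mark (startCell r h)) h in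
        qs , e , subst (Holds qs (front width))
          (trans (neighbourhoods-row (λ r l h c → mark (startCell r h)) input) (row-cong ℓ local)) h′
        where
        extended : ∀ j → j < ℓ → cut ℓ falses input (suc j) ≡ input (suc j)
        extended j h with m≤n⇒m<n∨m≡n h
        ... | inj₁ lt = cut-< ℓ falses input (suc j) lt
        ... | inj₂ eq = trans (cong (cut ℓ falses input) eq)
                          (trans (cut-end ℓ falses input) (input-beyond (sym eq)))
        local : ∀ j → j < ℓ → mark (startCell (cut ℓ falses input (suc j)) (input 0))
                              ≡ mark (configCell flag₀ (config 0) j)
        local j h = cong mark (trans (cong (λ r → startCell r (input 0)) (extended j h))
                                 (startCell-correct w X Y j))

      -- Neither half of a tape is initially longer than an input, and a step lengthens it by at
      -- most one.
      fits-config : ∀ j → FitsAll (j + (length w + mₙ)) (config j)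
      fits-config zero = fits-initial (w ∷ X ∷ Y ∷ [])
        λ { 0F → m≤m+n _ _
          ; 1F → ≤-trans (≤-reflexive (length-toList x)) (m≤n+m _ _)
          ; 2F → ≤-trans (≤-reflexive (length-toList y)) (m≤n+m _ _) }
      fits-config (suc j) =
        subst (FitsAll _) (sym (run-suc j (config 0))) (fits-next (config j) (fits-config j))

      run-steps : ∀ {ps} → Holds ps (front width) (configRow flag₀ (config 0) ℓ) →
        ∃ λ qs → ps ⟹[ times T# stepTemplate ] qs ×
          Holds qs (front width) (configRow flag₀ (config Tₙ) ℓ)
      run-steps = run-times T# stepTemplate
        (λ j ps → Holds ps (front width) (configRow flag₀ (config j) ℓ))
        (λ j j<T h → subst (λ c → ∃ λ qs → _ ⟹[ stepTemplate ] qs ×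
                               Holds qs (front width) (configRow flag₀ c ℓ))
          (sym (run-suc j (config 0))) (run-step flag₀ (config j) (fits j j<T) h))
        where
        arith : ∀ T N m → T + (N + m) + 2 ≡ 2 + (N + (m + T))
        arith = solve-∀
        fits : ∀ j → j < Tₙ → FitsAll ℓ (config j)
        fits j h i = fits-mono (lookup (proj₂ (config j)) i)
          (≤-trans (+-monoˡ-≤ _ (<⇒≤ h)) (≤-trans (m≤m+n _ 2) (≤-reflexive (arith Tₙ (length w) mₙ))))
          (fits-config j i)

      opaque
        unfolding template

        run-template :
          ∃ λ us → toList (x Vec.++ y) ⟶[ gates template w ] us ×
            nth us 0 ≡ just (isOne (Tape.scanned (Vec.head (proj₂ (config Tₙ)))) ∧ flag₀)
        run-template =
          let ps₁ , e₁ , h₁ = run-input x y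
              ps₂ , e₂ , h₂ = run-start h₁
              ps₃ , e₃ , h₃ = run-steps h₂
              -- `accept` is evaluated at all cells; the newest wire carries its value at cell 0.
              js  , _  , e₄ = run-shannon accept (front width) h₃
          in _ , e₁ ◅◅ steps (e₂ ▹ e₃ ▹ e₄) _ , cong just (accept-config flag₀ (config Tₙ))

  reduce : Exp
  reduce = description (m# ⊞ m#) template

  module _ (P : List Bool → List Bool → List Bool → Bool)
           (halts : ∀ w x y → Machine.HaltsWithin M (⟦ t ⟧ (length w + (length x + (length y + 0))))
                                (w ∷ x ∷ y ∷ []) (P w x y ∷ []))
           (w : List Bool) where

    output-bit : ∀ (x y : Vec Bool (mₙ w)) →
      isOne (Tape.scanned (Vec.head (proj₂ (config w x y (Tₙ w))))) ≡ P w (toList x) (toList y)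
    output-bit x y = scanned-output (config w x y (Tₙ w))
      (subst (λ T → Machine.output M (config w x y T) ≡ P w (toList x) (toList y) ∷ []) time
        (proj₂ (halts w (toList x) (toList y))))
      where
      time : ⟦ t ⟧ (length w + (length (toList x) + (length (toList y) + 0))) ≡ Tₙ w
      time = trans
        (cong ⟦ t ⟧ (cong₂ (λ a b → length w + (a + (b + 0))) (length-toList x) (length-toList y)))
        (sym (horner-correct t (len ⊞ (m# ⊞ (m# ⊞ lit 0))) (length w)))

    circuit : ∃ λ (C : Circuit (⟦ p ⟧ (length w) + ⟦ p ⟧ (length w))) →
      str reduce w ≡ encode C ×
      (∀ (x y : Vec Bool (⟦ p ⟧ (length w))) →
        eval C (x Vec.++ y) ≡ P w (toList x) (toList y) ∧ value (nth (toList x) 0))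
    circuit = subst
      (λ m → ∃ λ (C : Circuit (m + m)) → str reduce w ≡ encode C ×
        (∀ (x y : Vec Bool m) →
          eval C (x Vec.++ y) ≡ P w (toList x) (toList y) ∧ value (nth (toList x) 0)))
      (horner-correct p len (length w))
      -- The evaluation on zeros provides the typed circuit; the evaluations on all `x` and `y` then
      -- give its values.
      (let C , text , correct = described (m# ⊞ m#) template w (zeros Vec.++ zeros)
                                  (proj₁ (proj₂ start-run)) (proj₂ (proj₂ start-run)) in
       C , text , λ x y → let us , e , at = run-template w x y in
         trans (correct (x Vec.++ y) e at)
           (cong (_∧ value (nth (toList x) 0)) (output-bit x y)))
      where
      zeros : Vec Bool (mₙ w)
      zeros = Vec.replicate (mₙ w) false
      start-run = run-template w zeros zeros

-- Weak sources of the printed circuit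

theorem3p4 : L₂ᴾ ⊆ PTW
theorem3p4 {L} (P , p , (M , t , halts) , order) = str reduce , str-polyTime reduce , equivalent
  where
  open Reduction M p t
  ∧-elimˡ : ∀ {a b} → a ∧ b ≡ true → a ≡ true
  ∧-elimˡ {true} _ = refl
  equivalent : ∀ w → L w ⇔ WeakTournamentSource (str reduce w)
  equivalent w with circuit P (λ w x y → halts (w ∷ x ∷ y ∷ [])) w | order w
  ... | C , text , correct | sto , a , minimal , a₁ , as , a≡ , reflects =
    mk⇔ (to reflects) (from reflects)
    where
    l = ⟦ p ⟧ (length w)
    _≺_ : Vec Bool l → Vec Bool l → Set
    x ≺ y = P w (toList x) (toList y) ≡ true
    first : value (nth (toList a) 0) ≡ a₁
    first = cong (λ l → value (nth l 0)) a≡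
    not-below : ∀ {x y} → y ≺ x → P w (toList x) (toList y) ≡ false
    not-below {x} {y} y≺x with P w (toList x) (toList y) in eq
    ... | false = refl
    ... | true  = contradiction y≺x (IsStrictTotalOrder.asym sto eq)
    -- Being a source is vacuous if there is only one string. The first bit of a guarantees a second
    -- string, on which C(a‖y) = 0 refutes a when a₁ = 0.
    other : ∀ {m} (v : Vec Bool m) {b bs} → toList v ≡ b ∷ bs → ∃ λ u → u ≢ v
    other (b ∷ v) _ = not b ∷ v , λ eq → Bool.not-¬ refl (sym (cong Vec.head eq))
    to : Reflects (L w) a₁ → L w → WeakTournamentSource (str reduce w)
    to (ofⁿ ∉L) ∈L = contradiction ∈L ∉L
    to (ofʸ _)  _  = l , C , text , a , λ y y≢a →
      trans (correct a y) (cong₂ _∧_ (minimal y y≢a) first) ,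
      -- Asymmetry gives P(w,y,a) = 0, hence C(y‖a) = 0 whatever the first bit of y.
      trans (correct y a) (cong (_∧ _) (not-below (minimal y y≢a)))
    no-source : a₁ ≡ false → ¬ HasWeakSource l C
    no-source refl (x , source) with ≡-dec Bool._≟_ x a
    ... | yes refl with other a a≡
    ... | y , y≢a = contradiction
      (trans (sym (proj₁ (source y y≢a))) (trans (correct a y)
        (trans (cong (P w (toList a) (toList y) ∧_) first) (Bool.∧-zeroʳ (P w (toList a) (toList y))))))
      λ ()
    no-source refl (x , source) | no x≢a =
      IsStrictTotalOrder.asym sto (minimal x x≢a)
        (∧-elimˡ (trans (sym (correct x a)) (proj₁ (source a (x≢a ∘ sym)))))
    from : Reflects (L w) a₁ → WeakTournamentSource (str reduce w) → L w
    from (ofʸ ∈L) _ = ∈L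
    -- The given source belongs to a circuit that merely has the same code; unique readability
    -- identifies it with `C`.
    from (ofⁿ ∉L) (m′ , C′ , text′ , source) with encode-injective l m′ C C′ (trans (sym text) text′)
    ... | refl , refl = contradiction source (no-source refl)
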